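{- Let $G$ be a finite simple undirected graph and let $(G_i)_{i\ge 1}$ be its clean-factor series, with levels $V_0,V_1,V_2,\ldots$. Then for every $k\ge 2$, the map $\phi$ defined by $x\mapsto S(x)$, where $S(x)=(O_1(x),\ldots,O_{k-1}(x))$ is the characterising sequence of $x\in V_k$, is a bijection from $V_k$ to $$\{(O_1,\ldots,O_{k-1})\in\mathcal{O}^{k-1} \mid O_1\subsetneq O_2\subsetneq\cdots\subsetneq O_{k-1}\}.$$
   Context: All graphs are finite, undirected and simple. A $k$-partite graph $G=(V_0,\ldots,V_{k-1},E)$ is a graph together with an ordered partition $(V_0,\ldots,V_{k-1})$ of its vertex set into $k$ non-empty parts (levels) such that every edge joins vertices in different parts. $N(x)$ is the neighbourhood of $x$ and $N_i(x)=N(x)\cap V_i$. Factorisation. Given a $k$-partite graph $G=(V_0,\ldots,V_{k-1},E)$ with $k\ge 2$ and a set $V'_k$ of subsets of $V(G)$, the factorisation of $G$ with respect to $V'_k$ is the graph $G'=(V_0,\ldots,V_k,E\cup E_+)$, where the new level $V_k$ is the set of inclusion-maximal elements of $V'_k$ and $E_+=\{Xy \mid X\in V_k,\ y\in X\}$. It is called effective if $V_k\neq\emptyset$. The set $V^+_k$. For a $k$-partite graph, $V^+_k$ is the set of all sets $\{x_1,\ldots,x_l\}\cup\bigcap_{1\le i\le l}N(x_i)$ where $l\ge 2$, $x_1,\ldots,x_l$ are distinct elements of $V_{k-1}$, and $|\bigcap_{1\le i\le l}N(x_i)|\ge 2$. The set $V^*_k$. - If $k\ge 5$: $V^*_k$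 is the set of $X\in V^+_k$ such that $|\bigcap_{x\in X\cap V_{k-1}}N_{k-2}(x)|\ge 2$, and $N_{k-3}(x)=N_{k-3}(y)$ for all $x,y\in X\cap V_{k-1}$, and $|\bigcap_{x\in X\cap V_{k-1}}N_1(x)|\ge 2$. - If $k=4$: $V^*_4$ is the set of $X\in V^+_4$ such that $|\bigcap_{x\in X\cap V_3}N_2(x)|\ge 2$, $|\bigcap_{x\in X\cap V_3}N_1(x)|\ge 2$, and $N_0(x)=N_0(y)$ for all $x,y\in X\cap V_3$. - If $k=3$: $V^*_3$ is the set of $X\in V^+_3$ such that $|\bigcap_{x\in X\cap V_2}N_1(x)|\ge 2$ and $|\bigcap_{x\in X\cap V_2}N_0(x)|\ge 2$. - If $k=2$: $V^*_2=V^+_2$. The clean-factor graph of a $k$-partite graph is its factorisation with respect to $V^*_k$. Clean-factor series of a graph $G$. $\mathcal{K}(G)$ is the set of maximal cliques of $G$. $G_1=B(G)$ is the vertex-clique-incidence bipartite graph: level $V_0=V(G)$, level $V_1=\mathcal{K}(G)$, with an edge $vC$ whenever $v\in C$. For $i\ge 1$, $G_{i+1}$ is the clean-factor graph of $G_i$ if that factorisation is effective, and is undefined otherwise. Each step adds one new level, so $G_i$ has levels $V_0,\ldots,V_i$; when the series stops before level $V_k$ is created, $V_k$ is taken to be empty. Intersections of cliques. $\mathcal{O}'=\{O\subseteq V(G) \mid \exists P\subseteq\mathcal{K}(G),\ O=\bigcap_{C\in P}C\}$ with the convention $\bigcap_{C\in\varnothing}C=V(G)$. $\mathcal{O}$ is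 the set of $O\in\mathcal{O}'$ with $|O|\ge 2$ that can be written as the intersection of at least two pairwise distinct maximal cliques of $G$. For $A\subseteq V(G)$, $K(A)=\{C\in\mathcal{K}(G) \mid A\subseteq C\}$. Characterising sequence. For $k\ge 2$ and $x\in V_k$, $S(x)=(O_1(x),\ldots,O_{k-1}(x))$, where $O_1(x)=N_0(x)$ and, for $k\ge 3$ and each $j$ with $2\le j\le k-1$, $O_j(x)$ is the unique element of $\mathcal{O}'$ such that $K(O_j(x))=\bigcap_{y\in N_j(x)}N_1(y)$ (such an element exists and is unique; $V_1$ is identified with $\mathcal{K}(G)$). -}

module Defs where

open import Data.Bool.Base using (if_then_else_)
import Data.Bool.Properties as Bool
open import Data.Empty using () renaming (⊥ to Absurd)
open import Data.Fin.Base as Fin using (Fin; zero; suc; toℕ; fromℕ; inject₁; splitAt; _↑ˡ_; _↑ʳ_)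
import Data.Fin.Properties as Fin
open import Data.Fin.Subset using (Subset; inside; outside; _∈_; _⊆_; _⊂_; _∩_; _∪_; ∣_∣)
open import Data.Fin.Subset.Properties using (_∈?_; _⊆?_; _⊂?_; anySubset?)
open import Data.List.Base as List using (List; []; _∷_; _++_; length; filter; null)
open import Data.Maybe.Base using (Maybe; just; nothing; _>>=_)
open import Data.Nat.Base using (ℕ; zero; suc; _+_; _≤_)
import Data.Nat.Properties as ℕ
open import Data.Product.Base using (Σ-syntax; ∃-syntax; _×_; _,_)
open import Data.Sum.Base using (_⊎_; inj₁; inj₂; [_,_]′)
open import Data.Unit.Base using (tt) renaming (⊤ to Trivial)
open import Data.Vec.Base as Vec using (Vec; tabulate)
import Data.Vec.Properties as Vec
open import Data.Vec.Relation.Unary.All using (All)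
open import Data.Vec.Relation.Unary.Linked using (Linked)
open import Function.Base using (_∘_)
open import Level using (0ℓ)
open import Relation.Binary.Core using (Rel)
open import Relation.Binary.Definitions as Binary using (DecidableEquality; Symmetric; Irreflexive)
open import Relation.Binary.PropositionalEquality using (_≡_; _≢_; refl; sym; cong)
open import Relation.Nullary using (¬_; Dec; yes; no; does; ¬?; _×-dec_; _→-dec_)
open import Relation.Unary using (Pred; Decidable)

private
  variable
    k m n : ℕ

------------------------------------------------------------------------
-- Finite sets

⟦_⟧ : {P : Pred (Fin n) 0ℓ} → Decidable P → Subset n
⟦ P? ⟧ = tabulate (does ∘ P?)

-- The intersection of F x over all x ∈ A; it is everything when A is empty.
⋂[_]_ : Subset m → (Fin m → Subset n) → Subset n
⋂[ A ] F = ⟦ (λ y → Fin.all? (λ x → (x ∈? A) →-dec (y ∈? F x))) ⟧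

_≟ˢ_ : DecidableEquality (Subset n)
_≟ˢ_ = Vec.≡-dec Bool._≟_

subsets : ∀ n → List (Subset n)
subsets zero    = Vec.[] ∷ []
subsets (suc n) = List.map (inside Vec.∷_) (subsets n) ++ List.map (outside Vec.∷_) (subsets n)

Maximal : Pred (Subset n) 0ℓ → Pred (Subset n) 0ℓ
Maximal P X = P X × ¬ (∃[ Y ] P Y × X ⊂ Y)

maximal? : {P : Pred (Subset n) 0ℓ} → Decidable P → Decidable (Maximal P)
maximal? P? X = P? X ×-dec ¬? (anySubset? (λ Y → P? Y ×-dec (X ⊂? Y)))

-- Each inclusion-maximal set occurs exactly once in this list, so its
-- positions can serve as names for the maximal sets.
maximals : {P : Pred (Subset n) 0ℓ} → Decidable P → List (Subset n)
maximals {n = n} P? = filter (maximal? P?) (subsets n)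

------------------------------------------------------------------------
-- Graphs and k-partite graphs

record Graph (n : ℕ) : Set₁ where
  field
    Adj        : Rel (Fin n) 0ℓ
    _adj?_     : Binary.Decidable Adj
    adj-sym    : Symmetric Adj
    adj-irrefl : Irreflexive _≡_ Adj

  N : Fin n → Subset n
  N x = ⟦ (x adj?_) ⟧

-- Parts are allowed to be empty, so that the vertex-clique-incidence graph is
-- also defined for the graph without vertices.  The levels created in the
-- clean-factor series are non-empty because each factorisation is effective.
record PartiteGraph (k : ℕ) : Set₁ where
  field
    order   : ℕ
    graph   : Graph order
    level   : Fin order → Fin k
  open Graph graph public
  field
    partite : ∀ {x y} → Adj x y → level x ≢ level y

  Vertex : Set
  Vertex = Fin order

  part : ℕ → Subset order
  part i = ⟦ (λ x → toℕ (level x) ℕ.≟ i) ⟧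

  N[_] : ℕ → Vertex → Subset order
  N[ i ] x = N x ∩ part i

edgeless : ℕ → PartiteGraph 1
edgeless n = record
  { order   = n
  ; graph   = record
    { Adj        = λ _ _ → Absurd
    ; _adj?_     = λ _ _ → no λ ()
    ; adj-sym    = λ ()
    ; adj-irrefl = λ _ ()
    }
  ; level   = λ _ → zero
  ; partite = λ ()
  }

-- The old vertices are numbered first, followed by one new vertex for each
-- list entry X, adjacent to exactly the elements of X.
module AddLevel (H : PartiteGraph k) (Xs : List (Subset (PartiteGraph.order H))) where
  open PartiteGraph H

  private
    V : Set
    V = Vertex ⊎ Fin (length Xs)

    split : Fin (order + length Xs) → V
    split = splitAt order

  Adj⁺ : Rel V 0ℓ
  Adj⁺ (inj₁ x) (inj₁ y) = Adj x y
  Adj⁺ (inj₁ x) (inj₂ j) = x ∈ List.lookup Xs j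
  Adj⁺ (inj₂ i) (inj₁ y) = y ∈ List.lookup Xs i
  Adj⁺ (inj₂ i) (inj₂ j) = Absurd

  adj⁺? : Binary.Decidable Adj⁺
  adj⁺? (inj₁ x) (inj₁ y) = x adj? y
  adj⁺? (inj₁ x) (inj₂ j) = x ∈? List.lookup Xs j
  adj⁺? (inj₂ i) (inj₁ y) = y ∈? List.lookup Xs i
  adj⁺? (inj₂ i) (inj₂ j) = no λ ()

  adj⁺-sym : ∀ u v → Adj⁺ u v → Adj⁺ v u
  adj⁺-sym (inj₁ x) (inj₁ y) p = adj-sym p
  adj⁺-sym (inj₁ x) (inj₂ j) p = p
  adj⁺-sym (inj₂ i) (inj₁ y) p = p

  level⁺ : V → Fin (suc k)
  level⁺ = [ inject₁ ∘ level , (λ _ → fromℕ k) ]′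

  partite⁺ : ∀ u v → Adj⁺ u v → level⁺ u ≢ level⁺ v
  partite⁺ (inj₁ x) (inj₁ y) p e = partite p (Fin.inject₁-injective e)
  partite⁺ (inj₁ x) (inj₂ j) p e = Fin.fromℕ≢inject₁ (sym e)
  partite⁺ (inj₂ i) (inj₁ y) p e = Fin.fromℕ≢inject₁ e

  result : PartiteGraph (suc k)
  result = record
    { order   = order + length Xs
    ; graph   = record
      { Adj        = λ x y → Adj⁺ (split x) (split y)
      ; _adj?_     = λ x y → adj⁺? (split x) (split y)
      ; adj-sym    = λ {x} {y} → adj⁺-sym (split x) (split y)
      ; adj-irrefl = λ {x} {y} x≡y p →
          partite⁺ (split x) (split y) p (cong (level⁺ ∘ split) x≡y)
      }
    ; level   = level⁺ ∘ split
    ; partite = λ {x} {y} → partite⁺ (split x) (split y)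
    }

addLevel : (H : PartiteGraph k) → List (Subset (PartiteGraph.order H)) → PartiteGraph (suc k)
addLevel = AddLevel.result

------------------------------------------------------------------------
-- Factorisations

module _ (H : PartiteGraph k) {P : Pred (Subset (PartiteGraph.order H)) 0ℓ} (P? : Decidable P) where

  factorisation : PartiteGraph (suc k)
  factorisation = addLevel H (maximals P?)

-- For a k-partite graph with k = 2 + i, the last level has index 1 + i.
module _ {i : ℕ} (H : PartiteGraph (2 + i)) where
  open PartiteGraph H

  -- The set A plays the role of {x₁, …, xₗ}.
  V⁺ : Pred (Subset order) 0ℓ
  V⁺ X = ∃[ A ] A ⊆ part (1 + i) × 2 ≤ ∣ A ∣ × 2 ≤ ∣ ⋂[ A ] N ∣ × X ≡ A ∪ (⋂[ A ] N)

  V⁺? : Decidable V⁺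
  V⁺? X = anySubset? λ A →
    (A ⊆? part (1 + i)) ×-dec (2 ℕ.≤? ∣ A ∣) ×-dec (2 ℕ.≤? ∣ ⋂[ A ] N ∣) ×-dec (X ≟ˢ (A ∪ (⋂[ A ] N)))

module _ (H : PartiteGraph k) where
  open PartiteGraph H

  CommonNeighbours≥2 : ℕ → Pred (Subset order) 0ℓ
  CommonNeighbours≥2 j A = 2 ≤ ∣ ⋂[ A ] N[ j ] ∣

  SameNeighbours : ℕ → Pred (Subset order) 0ℓ
  SameNeighbours j A = ∀ x → x ∈ A → ∀ y → y ∈ A → N[ j ] x ≡ N[ j ] y

  commonNeighbours≥2? : ∀ j → Decidable (CommonNeighbours≥2 j)
  commonNeighbours≥2? j A = 2 ℕ.≤? ∣ ⋂[ A ] N[ j ] ∣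

  sameNeighbours? : ∀ j → Decidable (SameNeighbours j)
  sameNeighbours? j A = Fin.all? λ x → (x ∈? A) →-dec
    Fin.all? λ y → (y ∈? A) →-dec (N[ j ] x ≟ˢ N[ j ] y)

-- The cases are k = 2, k = 3, k = 4 and k = 5 + i; A stands for X ∩ V_{k-1}.
CleanCondition : ∀ i (H : PartiteGraph (2 + i)) → Pred (Subset (PartiteGraph.order H)) 0ℓ
CleanCondition 0 H A = Trivial
CleanCondition 1 H A = CommonNeighbours≥2 H 1 A × CommonNeighbours≥2 H 0 A
CleanCondition 2 H A = CommonNeighbours≥2 H 2 A × CommonNeighbours≥2 H 1 A × SameNeighbours H 0 A
CleanCondition (suc (suc (suc i))) H A =
  CommonNeighbours≥2 H (3 + i) A × SameNeighbours H (2 + i) A × CommonNeighbours≥2 H 1 A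

cleanCondition? : ∀ i (H : PartiteGraph (2 + i)) → Decidable (CleanCondition i H)
cleanCondition? 0 H A = yes tt
cleanCondition? 1 H A = commonNeighbours≥2? H 1 A ×-dec commonNeighbours≥2? H 0 A
cleanCondition? 2 H A =
  commonNeighbours≥2? H 2 A ×-dec commonNeighbours≥2? H 1 A ×-dec sameNeighbours? H 0 A
cleanCondition? (suc (suc (suc i))) H A =
  commonNeighbours≥2? H (3 + i) A ×-dec sameNeighbours? H (2 + i) A ×-dec commonNeighbours≥2? H 1 A

module _ {i : ℕ} (H : PartiteGraph (2 + i)) where
  open PartiteGraph H

  V* : Pred (Subset order) 0ℓ
  V* X = V⁺ H X × CleanCondition i H (X ∩ part (1 + i))

  V*? : Decidable V*
  V*? X = V⁺? H X ×-dec cleanCondition? i H (X ∩ part (1 + i))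

  cleanFactor : PartiteGraph (3 + i)
  cleanFactor = factorisation H V*?

------------------------------------------------------------------------
-- Cliques and their intersections

module _ (G : Graph n) where
  open Graph G

  IsClique : Pred (Subset n) 0ℓ
  IsClique C = ∀ x → x ∈ C → ∀ y → y ∈ C → x ≢ y → Adj x y

  isClique? : Decidable IsClique
  isClique? C = Fin.all? λ x → (x ∈? C) →-dec
    Fin.all? λ y → (y ∈? C) →-dec (¬? (x Fin.≟ y) →-dec (x adj? y))

  maximalCliques : List (Subset n)
  maximalCliques = maximals isClique?

  𝒦 : Set
  𝒦 = Fin (length maximalCliques)

  members : 𝒦 → Subset n
  members = List.lookup maximalCliques

  𝒪′ : Pred (Subset n) 0ℓ
  𝒪′ O = ∃[ P ] O ≡ ⋂[ P ] members

  𝒪 : Pred (Subset n) 0ℓ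
  𝒪 O = 2 ≤ ∣ O ∣ × (∃[ P ] 2 ≤ ∣ P ∣ × O ≡ ⋂[ P ] members)

  K : Subset n → Subset (length maximalCliques)
  K A = ⟦ (λ C → A ⊆? members C) ⟧

  B : PartiteGraph 2
  B = addLevel (edgeless n) maximalCliques

------------------------------------------------------------------------
-- The clean-factor series

-- A k-partite graph of the series, in which V₀ and V₁ are identified with the
-- vertices and with the maximal cliques of G, respectively.
record Stage (G : Graph n) (k : ℕ) : Set₁ where
  field
    partiteGraph : PartiteGraph k
  open PartiteGraph partiteGraph public
  field
    vertex : Fin n → Vertex
    clique : 𝒦 G → Vertex

  N₀ : Vertex → Subset n
  N₀ x = ⟦ (λ v → vertex v ∈? N[ 0 ] x) ⟧

  N₁ : Vertex → Subset (length (maximalCliques G))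
  N₁ x = ⟦ (λ C → clique C ∈? N[ 1 ] x) ⟧

module _ (G : Graph n) where

  firstStage : Stage G 2
  firstStage = record
    { partiteGraph = B G
    ; vertex       = _↑ˡ length (maximalCliques G)
    ; clique       = n ↑ʳ_
    }

  nextStage : ∀ {i} → Stage G (2 + i) → Maybe (Stage G (3 + i))
  nextStage s = if null newLevel then nothing else just (record
    { partiteGraph = cleanFactor (Stage.partiteGraph s)
    ; vertex       = (_↑ˡ length newLevel) ∘ Stage.vertex s
    ; clique       = (_↑ˡ length newLevel) ∘ Stage.clique s
    })
    where newLevel = maximals (V*? (Stage.partiteGraph s))

  -- series i is G_{i+1}, which has levels V₀, …, V_{i+1}.
  series : ∀ i → Maybe (Stage G (2 + i))
  series zero    = just firstStage
  series (suc i) = series i >>= nextStage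

LastLevel : {G : Graph n} → Maybe (Stage G (suc k)) → Set
LastLevel         nothing  = Absurd
LastLevel {k = k} (just s) = Σ[ x ∈ Stage.Vertex s ] toℕ (Stage.level s x) ≡ k

V[2+_] : ℕ → Graph n → Set
V[2+ m ] G = LastLevel (series G (suc m))

------------------------------------------------------------------------
-- Characterising sequences

module _ {G : Graph n} where

  -- Os is (O₁, …, O_{k-1}) for k = 2 + m, so the entry at index j is O_{j+1}.
  IsCharacterising : (s : Maybe (Stage G (3 + m))) → LastLevel s → Vec (Subset n) (suc m) → Set
  IsCharacterising {m = m} (just s) (x , _) Os =
    Vec.lookup Os zero ≡ N₀ x ×
    (∀ (j : Fin m) →
      𝒪′ G (Vec.lookup Os (suc j)) ×
      K G (Vec.lookup Os (suc j)) ≡ ⋂[ N[ 2 + toℕ j ] x ] N₁)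
    where open Stage s

-- S(x) is the only sequence Os such that x HasSequence Os.
HasSequence : (G : Graph n) (m : ℕ) → V[2+ m ] G → Vec (Subset n) (suc m) → Set
HasSequence G m = IsCharacterising (series G (suc m))

StrictChain : Graph n → ℕ → Set
StrictChain {n} G l = Σ[ Os ∈ Vec (Subset n) l ] All (𝒪 G) Os × Linked _⊂_ Os

{-# OPTIONS --safe #-}
module Submission where

-- A vertex (O₁, …, O_l) of level V_{l+1}, l ≥ 1, sees below it exactly the vertices of G in O₁, the
-- maximal cliques containing O_l, and the chains (O₁, …, O_{j-1}, b) with O_j ⊆ b ⊆ O_{j+1}, j < l.
-- If this holds up to level V_{k-1}, write D(O₁, …, O_{k-1}) for the set which the new chain would see.
-- Each D of a strict chain belongs to V*_k; each X ∈ V*_k lies in such a D, because the clean condition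
-- forces the elements of X ∩ V_{k-1} to agree except in their last entries b, and for k ≥ 3 one takes
-- as O_{k-2} the intersection of these b and as O_{k-1} that of all maximal cliques containing them; and
-- D determines its chain from inclusions alone.  So the maximal elements of V*_k are the sets D.

open import Defs
open import Data.Bool.Base using (Bool; true; false; if_then_else_)
open import Data.Empty using (⊥)
open import Data.Fin.Base as Fin using (Fin; zero; suc; toℕ; splitAt; _↑ˡ_; _↑ʳ_)
import Data.Fin.Properties as Fin
open import Data.Fin.Subset using (Subset; inside; outside; _∈_; _⊆_; _⊂_; _∩_; _∪_; ∣_∣; ⁅_⁆)
open import Data.Fin.Subset.Properties
  using ( _∈?_; _⊆?_; ⊆-antisym; ⊆-trans; ⊂-trans; ⊂-irref; p⊂q⇒∣p∣<∣q∣; ∣⁅x⁆∣≡1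
        ; x∈⁅y⁆⇒x≡y; x∈p∩q⁺; x∈p∩q⁻; x∈p∪q⁻; p⊆p∪q; q⊆p∪q)
open import Data.Fin.Relation.Unary.Top using (view; ‵fromℕ; ‵inject₁)
open import Data.List.Base as List using (List; []; _∷_; length; null)
open import Data.List.Membership.Propositional using () renaming (_∈_ to _∈ˡ_)
open import Data.List.Membership.Propositional.Properties
  using (∈-lookup; ∈-filter⁺; ∈-filter⁻; ∈-map⁺; ∈-map⁻; ∈-++⁺ˡ; ∈-++⁺ʳ)
import Data.List.Properties as List
open import Data.List.Relation.Unary.All as Allˡ using ([]; _∷_)
open import Data.List.Relation.Unary.AllPairs using ([]; _∷_)
open import Data.List.Relation.Unary.Any as Any using (here; there)
open import Data.List.Relation.Unary.Any.Properties using (lookup-index)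
open import Data.List.Relation.Unary.Linked as Linkedˡ using ([]; [-]; _∷_)
open import Data.List.Relation.Unary.Unique.Propositional using (Unique)
import Data.List.Relation.Unary.Unique.Propositional.Properties as Unique
open import Data.Maybe.Base using (Maybe; just; nothing; _>>=_)
open import Data.Nat.Base using (ℕ; zero; suc; _+_; _≤_; _<_; z≤n; s≤s)
import Data.Nat.Properties as ℕ
open import Data.Product.Base using (Σ-syntax; ∃; ∃₂; ∃-syntax; _×_; _,_; proj₁; proj₂)
open import Data.Sum.Base using (_⊎_; inj₁; inj₂; [_,_]′)
open import Data.Unit.Base using (⊤; tt)
open import Data.Vec.Base as Vec using (Vec; []; _∷_; _∷ʳ_)
import Data.Vec.Properties as Vec
open import Data.Vec.Relation.Unary.All as Allᵛ using ([]; _∷_)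
open import Data.Vec.Relation.Unary.Linked as Linkedᵛ using ([]; [-]; _∷_)
open import Function.Base using (_on_; _∘_; flip)
open import Function.Bundles using (_⇔_; mk⇔)
open import Function.Definitions using (Injective; Bijective)
open import Level using (0ℓ)
open import Relation.Binary.PropositionalEquality
  using (_≡_; _≢_; refl; sym; trans; cong; cong₂; subst; subst₂)
open import Relation.Nullary using (¬_; Dec; yes; no; does; contradiction; ¬?; _×-dec_; _⊎-dec_; _→-dec_)
open import Relation.Nullary.Decidable using (map′; dec-true; decidable-stable)
open import Relation.Unary using (Pred; Decidable)

-- The graphs of the series only have numbered vertices, so the claim about neighbourhoods is
-- carried as an invariant: a labelling of all vertices by explicit nodes under which adjacency
-- becomes a concrete relation. When the series stops, the invariant records instead that no chain
-- of the required length exists.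
--
-- The shape of the clean condition comes from where a chain `(O₁, …, O_{k-2})` in `V_{k-1}` shows
-- its last entry. For `k ≥ 4` this happens only in `V₁`, through the cliques containing it, and in
-- `V_{k-2}`, through the upper end of the topmost interval; all other levels depend on the earlier
-- entries alone. For `k ≥ 5`, level `V_{k-3}` shows the interval from `O_{k-4}` to `O_{k-3}`, whose
-- ends reveal all earlier entries, so equality there is what makes them agree. For `k = 4` that
-- level would be `V₁`, which shows the last entry; the only earlier entry is then `O₁`, read off
-- from `V₀`. The cardinality conditions make the two new sets admissible: common neighbours in
-- `V_{k-2}` make the smaller one properly larger than `O_{k-3}` (for `k = 3`, those in `V₀` give it
-- two vertices), and those in `V₁` put the larger one into two cliques.

private
  variable
    k m n : ℕ

-- Finite subsets, their cardinalities and the list of maximal sets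

∈⟦⟧⁺ : {P : Pred (Fin n) 0ℓ} (P? : Decidable P) {x : Fin n} → P x → x ∈ ⟦ P? ⟧
∈⟦⟧⁺ P? {x} px = Vec.lookup⇒[]= x _ (trans (Vec.lookup∘tabulate _ x) (dec-true (P? x) px))

∈⟦⟧⁻ : {P : Pred (Fin n) 0ℓ} (P? : Decidable P) {x : Fin n} → x ∈ ⟦ P? ⟧ → P x
∈⟦⟧⁻ P? {x} x∈ with P? x | trans (sym (Vec.lookup∘tabulate (does ∘ P?) x)) (Vec.[]=⇒lookup x∈)
... | yes px | _ = px

∈⋂⁺ : (A : Subset m) {F : Fin m → Subset n} {y : Fin n} → (∀ {x} → x ∈ A → y ∈ F x) → y ∈ ⋂[ A ] F
∈⋂⁺ A {F} f = ∈⟦⟧⁺ {P = λ y → ∀ x → x ∈ A → y ∈ F x}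
  (λ y → Fin.all? λ x → (x ∈? A) →-dec (y ∈? F x)) (λ _ → f)

∈⋂⁻ : (A : Subset m) {F : Fin m → Subset n} {y : Fin n} → y ∈ ⋂[ A ] F → ∀ {x} → x ∈ A → y ∈ F x
∈⋂⁻ A {F} y∈ {x} = ∈⟦⟧⁻ {P = λ y → ∀ x → x ∈ A → y ∈ F x}
  (λ y → Fin.all? λ x → (x ∈? A) →-dec (y ∈? F x)) y∈ x

⊆∧≢⇒⊂ : {A B : Subset n} → A ⊆ B → A ≢ B → A ⊂ B
⊆∧≢⇒⊂ {A = A} {B} A⊆B A≢B with Fin.any? (λ x → (x ∈? B) ×-dec ¬? (x ∈? A))
... | yes w = A⊆B , w
... | no ¬w = contradiction
  (⊆-antisym A⊆B (λ {x} x∈B → decidable-stable (x ∈? A) (λ x∉A → ¬w (x , x∈B , x∉A)))) A≢B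

⊂⇒≢ : {A B : Subset n} → A ⊂ B → A ≢ B
⊂⇒≢ A⊂B A≡B = ⊂-irref A≡B A⊂B

-- Unlike `∣_∣`, this form of cardinality at least two can be moved between vertices of the series,
-- vertices of `G` and cliques.
AtLeastTwo : {A : Set} → Pred A 0ℓ → Set
AtLeastTwo P = ∃₂ λ x y → x ≢ y × P x × P y

-- A relation replaces a function because the labelling is used through equations such as
-- `node x ≡ vtx v`, which are followed in both directions.
AtLeastTwo-map : {A B : Set} {P : Pred A 0ℓ} {Q : Pred B 0ℓ} (R : A → B → Set) →
                 (∀ {x} → P x → ∃ λ y → R x y × Q y) →
                 (∀ {x x′ y} → R x y → R x′ y → x ≡ x′) →
                 AtLeastTwo P → AtLeastTwo Q
AtLeastTwo-map R image inj (x , x′ , x≢x′ , px , px′)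
  with y , r , qy ← image px | y′ , r′ , qy′ ← image px′ =
  y , y′ , (λ { refl → x≢x′ (inj r r′) }) , qy , qy′

2≤∣∣⁺ : {A : Subset n} → AtLeastTwo (_∈ A) → 2 ≤ ∣ A ∣
2≤∣∣⁺ {A = A} (x , y , x≢y , x∈A , y∈A) = subst (_< ∣ A ∣) (∣⁅x⁆∣≡1 x) (p⊂q⇒∣p∣<∣q∣
  ( (λ z∈ → subst (_∈ A) (sym (x∈⁅y⁆⇒x≡y x z∈)) x∈A)
  , y , y∈A , λ y∈ → x≢y (sym (x∈⁅y⁆⇒x≡y x y∈))))

1≤∣∣⁻ : {A : Subset n} → 1 ≤ ∣ A ∣ → ∃ (_∈ A)
1≤∣∣⁻ {A = inside  ∷ A} _ = zero , Vec.here
1≤∣∣⁻ {A = outside ∷ A} p with x , x∈ ← 1≤∣∣⁻ p = suc x , Vec.there x∈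

2≤∣∣⁻ : {A : Subset n} → 2 ≤ ∣ A ∣ → AtLeastTwo (_∈ A)
2≤∣∣⁻ {A = inside  ∷ A} (s≤s p) with x , x∈ ← 1≤∣∣⁻ p =
  zero , suc x , (λ ()) , Vec.here , Vec.there x∈
2≤∣∣⁻ {A = outside ∷ A} p with x , y , x≢y , x∈ , y∈ ← 2≤∣∣⁻ p =
  suc x , suc y , x≢y ∘ Fin.suc-injective , Vec.there x∈ , Vec.there y∈

∈-subsets : (A : Subset n) → A ∈ˡ subsets n
∈-subsets []            = here refl
∈-subsets (inside  ∷ A) = ∈-++⁺ˡ (∈-map⁺ _ (∈-subsets A))
∈-subsets (outside ∷ A) = ∈-++⁺ʳ _ (∈-map⁺ _ (∈-subsets A))

subsets-unique : ∀ n → Unique (subsets n)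
subsets-unique zero    = [] ∷ []
subsets-unique (suc n) = Unique.++⁺
  (Unique.map⁺ Vec.∷-injectiveʳ (subsets-unique n))
  (Unique.map⁺ Vec.∷-injectiveʳ (subsets-unique n))
  disjoint
  where
  disjoint : ∀ {A} → ¬ (A ∈ˡ List.map (inside ∷_) (subsets n) × A ∈ˡ List.map (outside ∷_) (subsets n))
  disjoint (p , q) with ∈-map⁻ _ p | ∈-map⁻ _ q
  ... | _ , _ , refl | _ , _ , ()

unique⇒lookup-injective : {A : Set} {xs : List A} → Unique xs → Injective _≡_ _≡_ (List.lookup xs)
unique⇒lookup-injective (_ ∷ _)  {zero}  {zero}  _ = refl
unique⇒lookup-injective (x∉ ∷ _) {zero}  {suc j} e = contradiction e (Allˡ.lookup x∉ (∈-lookup j))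
unique⇒lookup-injective (x∉ ∷ _) {suc i} {zero}  e = contradiction (sym e) (Allˡ.lookup x∉ (∈-lookup i))
unique⇒lookup-injective (_ ∷ u)  {suc i} {suc j} e = cong suc (unique⇒lookup-injective u e)

if-elim : {A : Set₁} (Q : A → Set) (b : Bool) {x y : A} →
          (b ≡ true → Q x) → (b ≡ false → Q y) → Q (if b then x else y)
if-elim Q true  f g = f refl
if-elim Q false f g = g refl

null⇒¬lookup : {A : Set} {xs : List A} {x : A} → null xs ≡ true → ¬ (∃ λ j → List.lookup xs j ≡ x)
null⇒¬lookup {xs = []} _ (() , _)

module _ {P : Pred (Subset n) 0ℓ} (P? : Decidable P) where

  maximals-injective : Injective _≡_ _≡_ (List.lookup (maximals P?))
  maximals-injective = unique⇒lookup-injective (Unique.filter⁺ (maximal? P?) (subsets-unique n))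

  lookup-maximals : ∀ j → Maximal P (List.lookup (maximals P?) j)
  lookup-maximals j = proj₂ (∈-filter⁻ (maximal? P?) {xs = subsets n} (∈-lookup j))

  maximals-complete : ∀ {X} → Maximal P X → ∃ λ j → List.lookup (maximals P?) j ≡ X
  maximals-complete {X} mx = Any.index X∈ , sym (lookup-index X∈)
    where X∈ = ∈-filter⁺ (maximal? P?) (∈-subsets X) mx

-- Vectors and reversal

lookup-∷ʳ-inject₁ : {A : Set} (xs : Vec A n) (x : A) (j : Fin n) →
                    Vec.lookup (xs ∷ʳ x) (Fin.inject₁ j) ≡ Vec.lookup xs j
lookup-∷ʳ-inject₁ (_ ∷ _)  x zero    = refl
lookup-∷ʳ-inject₁ (_ ∷ xs) x (suc j) = lookup-∷ʳ-inject₁ xs x j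

lookup-∷ʳ-fromℕ : {A : Set} (xs : Vec A n) (x : A) → Vec.lookup (xs ∷ʳ x) (Fin.fromℕ n) ≡ x
lookup-∷ʳ-fromℕ []       x = refl
lookup-∷ʳ-fromℕ (_ ∷ xs) x = lookup-∷ʳ-fromℕ xs x

lookup-injective : {A : Set} {xs ys : Vec A n} → (∀ j → Vec.lookup xs j ≡ Vec.lookup ys j) → xs ≡ ys
lookup-injective {xs = xs} {ys} e =
  trans (sym (Vec.tabulate∘lookup xs)) (trans (Vec.tabulate-cong e) (Vec.tabulate∘lookup ys))

-- A chain grows at its large end, which suits lists headed by the largest set, while the theorem
-- orders the entries from the smallest. Taking the length as an equation avoids transports along
-- the index of `Vec`.
reverseᵛ : {A : Set} (xs : List A) → length xs ≡ n → Vec A n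
reverseᵛ {n = zero}  []       _ = []
reverseᵛ {n = suc _} (x ∷ xs) e = reverseᵛ xs (ℕ.suc-injective e) ∷ʳ x

reverseᵛ-cong : {A : Set} {xs ys : List A} → xs ≡ ys → (e : length xs ≡ n) (e′ : length ys ≡ n) →
                reverseᵛ xs e ≡ reverseᵛ ys e′
reverseᵛ-cong {xs = xs} refl e e′ = cong (reverseᵛ xs) (ℕ.≡-irrelevant e e′)

reverseᵛ-injective : {A : Set} (xs ys : List A) (e : length xs ≡ n) (e′ : length ys ≡ n) →
                     reverseᵛ xs e ≡ reverseᵛ ys e′ → xs ≡ ys
reverseᵛ-injective {n = zero}  []       []       _ _  _  = refl
reverseᵛ-injective {n = suc _} (x ∷ xs) (y ∷ ys) e e′ eq = cong₂ _∷_
  (Vec.∷ʳ-injectiveʳ (reverseᵛ xs _) (reverseᵛ ys _) eq)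
  (reverseᵛ-injective xs ys _ _ (Vec.∷ʳ-injectiveˡ (reverseᵛ xs _) (reverseᵛ ys _) eq))

module _ {A : Set} {P : Pred A 0ℓ} where

  all-∷ʳ⁺ : {xs : Vec A n} {x : A} → Allᵛ.All P xs → P x → Allᵛ.All P (xs ∷ʳ x)
  all-∷ʳ⁺ []         px = px ∷ []
  all-∷ʳ⁺ (py ∷ pys) px = py ∷ all-∷ʳ⁺ pys px

  all-∷ʳ⁻ : (xs : Vec A n) {x : A} → Allᵛ.All P (xs ∷ʳ x) → Allᵛ.All P xs × P x
  all-∷ʳ⁻ []       (px ∷ [])  = [] , px
  all-∷ʳ⁻ (_ ∷ xs) (py ∷ pxs) with pys , px ← all-∷ʳ⁻ xs pxs = py ∷ pys , px

  all-reverseᵛ⁺ : {xs : List A} → Allˡ.All P xs → (e : length xs ≡ n) → Allᵛ.All P (reverseᵛ xs e)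
  all-reverseᵛ⁺ []         refl = []
  all-reverseᵛ⁺ (px ∷ pxs) refl = all-∷ʳ⁺ (all-reverseᵛ⁺ pxs refl) px

module _ {A : Set} {R : A → A → Set} where

  linked-∷ʳ⁺ : (xs : Vec A n) {y x : A} → Linkedᵛ.Linked R (xs ∷ʳ y) → R y x → Linkedᵛ.Linked R (xs ∷ʳ y ∷ʳ x)
  linked-∷ʳ⁺ []           _        r = r ∷ [-]
  linked-∷ʳ⁺ (_ ∷ [])     (s ∷ ls) r = s ∷ linked-∷ʳ⁺ [] ls r
  linked-∷ʳ⁺ (_ ∷ z ∷ xs) (s ∷ ls) r = s ∷ linked-∷ʳ⁺ (z ∷ xs) ls r

  linked-∷ʳ⁻ : (xs : Vec A n) {x : A} → Linkedᵛ.Linked R (xs ∷ʳ x) → Linkedᵛ.Linked R xs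
  linked-∷ʳ⁻ []           _        = []
  linked-∷ʳ⁻ (_ ∷ [])     _        = [-]
  linked-∷ʳ⁻ (_ ∷ z ∷ xs) (r ∷ ls) = r ∷ linked-∷ʳ⁻ (z ∷ xs) ls

  linked-last : (xs : Vec A n) {y x : A} → Linkedᵛ.Linked R (xs ∷ʳ y ∷ʳ x) → R y x
  linked-last []           (r ∷ _)  = r
  linked-last (_ ∷ [])     (_ ∷ ls) = linked-last [] ls
  linked-last (_ ∷ z ∷ xs) (_ ∷ ls) = linked-last (z ∷ xs) ls

  linked-reverseᵛ⁺ : {xs : List A} → Linkedˡ.Linked (flip R) xs → (e : length xs ≡ n) →
                    Linkedᵛ.Linked R (reverseᵛ xs e)
  linked-reverseᵛ⁺ []                          refl = []
  linked-reverseᵛ⁺ [-]                         refl = [-]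
  linked-reverseᵛ⁺ {xs = _ ∷ _ ∷ xs} (r ∷ rs) refl =
    linked-∷ʳ⁺ (reverseᵛ xs refl) (linked-reverseᵛ⁺ rs refl) r

  reverseᵛ-surjective : {P : Pred A 0ℓ} (v : Vec A n) → Allᵛ.All P v → Linkedᵛ.Linked R v →
    Σ[ xs ∈ List A ] Allˡ.All P xs × Linkedˡ.Linked (flip R) xs × (Σ[ e ∈ length xs ≡ n ] reverseᵛ xs e ≡ v)
  reverseᵛ-surjective {n = zero} [] _ _ = [] , [] , [] , refl , refl
  reverseᵛ-surjective {n = suc n} v ps ls with Vec.initLast v
  ... | ys , y , refl with ps′ , p ← all-∷ʳ⁻ ys ps with reverseᵛ-surjective ys ps′ (linked-∷ʳ⁻ ys ls)
  ...   | []     , _  , _  , refl , refl = y ∷ [] , p ∷ [] , [-] , refl , refl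
  ...   | x ∷ xs , qs , ks , refl , refl =
    y ∷ x ∷ xs , p ∷ qs , linked-last (reverseᵛ xs refl) ls ∷ ks , refl , refl

-- Intersections of maximal cliques

module Nodes {n} (G : Graph n) where

  infix 4 _▷ᶜ_ _▷_ _▷?_

  K⁺ : ∀ {O C} → O ⊆ members G C → C ∈ K G O
  K⁺ {O} = ∈⟦⟧⁺ (λ C → O ⊆? members G C)

  K⁻ : ∀ {O C} → C ∈ K G O → O ⊆ members G C
  K⁻ {O} = ∈⟦⟧⁻ (λ C → O ⊆? members G C)

  -- The index set `P` in `𝒪` is traded for the largest possible one, all maximal cliques containing
  -- `O`; `closed` says that `O` contains their intersection.
  record IsIntersection (O : Subset n) : Set where
    field
      twoVertices : AtLeastTwo (_∈ O)
      twoCliques  : AtLeastTwo (λ C → O ⊆ members G C)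
      closed      : ∀ {v} → (∀ C → O ⊆ members G C → v ∈ members G C) → v ∈ O

    antitone : ∀ {A} → (∀ C → O ⊆ members G C → A ⊆ members G C) → A ⊆ O
    antitone f v∈A = closed (λ C O⊆C → f C O⊆C v∈A)

  open IsIntersection

  𝒪⇒IsIntersection : ∀ {O} → 𝒪 G O → IsIntersection O
  𝒪⇒IsIntersection (2≤O , P , 2≤P , refl) = record
    { twoVertices = 2≤∣∣⁻ 2≤O
    ; twoCliques  = let C , D , C≢D , C∈P , D∈P = 2≤∣∣⁻ 2≤P
                    in C , D , C≢D , (λ v∈ → ∈⋂⁻ P v∈ C∈P) , (λ v∈ → ∈⋂⁻ P v∈ D∈P)
    ; closed      = λ f → ∈⋂⁺ P (λ {C} C∈P → f C (λ v∈ → ∈⋂⁻ P v∈ C∈P))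
    }

  closed⇒≡⋂K : ∀ {O} → (∀ {v} → (∀ C → O ⊆ members G C → v ∈ members G C) → v ∈ O) →
               O ≡ ⋂[ K G O ] (members G)
  closed⇒≡⋂K {O} cl = ⊆-antisym
    (λ v∈O → ∈⋂⁺ (K G O) (λ C∈ → K⁻ C∈ v∈O))
    (λ v∈ → cl (λ C O⊆C → ∈⋂⁻ (K G O) v∈ (K⁺ O⊆C)))

  IsIntersection⇒𝒪 : ∀ {O} → IsIntersection O → 𝒪 G O
  IsIntersection⇒𝒪 {O} o =
    let C , D , C≢D , O⊆C , O⊆D = twoCliques o in
    2≤∣∣⁺ (twoVertices o) , K G O , 2≤∣∣⁺ (C , D , C≢D , K⁺ O⊆C , K⁺ O⊆D) , closed⇒≡⋂K (closed o)

  -- Source of the uniqueness of the characterising sequence: an element of `𝒪′` is recovered as the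
  -- intersection of all maximal cliques containing it.
  K-injective : ∀ {O O′} → 𝒪′ G O → 𝒪′ G O′ → K G O ≡ K G O′ → O ≡ O′
  K-injective (P , refl) (P′ , refl) e =
    trans (closed⇒≡⋂K (closedness P))
      (trans (cong (λ A → ⋂[ A ] (members G)) e) (sym (closed⇒≡⋂K (closedness P′))))
    where
    closedness : ∀ P {v} → (∀ C → ⋂[ P ] (members G) ⊆ members G C → v ∈ members G C) → v ∈ ⋂[ P ] (members G)
    closedness P f = ∈⋂⁺ P (λ {C} C∈P → f C (λ v∈ → ∈⋂⁻ P v∈ C∈P))

  -- Chains and the explicit adjacency relation

  -- Chains are listed from the largest set to the smallest one.
  Chain : List (Subset n) → Set
  Chain xs = Allˡ.All IsIntersection xs × Linkedˡ.Linked (flip _⊂_) xs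

  chain-tail : ∀ {o p} → Chain (o ∷ p) → Chain p
  chain-tail (_ ∷ os , ls) = os , Linkedˡ.tail ls

  -- With `chain-tail` this provides the two extreme chains, `c ∷ p` and `d ∷ p`, of the interval at
  -- the top of `d ∷ c ∷ p`.
  chain-skip : ∀ {d c p} → Chain (d ∷ c ∷ p) → Chain (d ∷ p)
  chain-skip (d∈ ∷ _ ∷ os , _ ∷ [-])        = d∈ ∷ os , [-]
  chain-skip (d∈ ∷ _ ∷ os , c⊂d ∷ e⊂c ∷ ls) = d∈ ∷ os , ⊂-trans e⊂c c⊂d ∷ ls

  -- The vertices of every graph of the series: vertices of G, maximal cliques of G, and chains;
  -- chn O_l (O_{l-1} ∷ … ∷ O₁ ∷ []) stands for (O₁, …, O_l), a vertex of level V_{l+1}.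
  data Node : Set where
    vtx : Fin n → Node
    clq : 𝒦 G → Node
    chn : Subset n → List (Subset n) → Node

  rank : Node → ℕ
  rank (vtx _)   = 0
  rank (clq _)   = 1
  rank (chn _ p) = 2 + length p

  Valid : Node → Set
  Valid (vtx _)   = ⊤
  Valid (clq _)   = ⊤
  Valid (chn o p) = Chain (o ∷ p)

  bottom : Subset n → List (Subset n) → Subset n
  bottom o []      = o
  bottom o (c ∷ p) = bottom c p

  -- (O₁, …, O_k) is adjacent to (O₁, …, O_{j-1}, b) exactly when j < k and O_j ⊆ b ⊆ O_{j+1}.
  data _▷ᶜ_ : List (Subset n) → List (Subset n) → Set where
    here  : ∀ {d c b p} → c ⊆ b → b ⊆ d → (d ∷ c ∷ p) ▷ᶜ (b ∷ p)
    there : ∀ {d xs ys} → xs ▷ᶜ ys → (d ∷ xs) ▷ᶜ ys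

  _▷_ : Node → Node → Set
  vtx v   ▷ _       = ⊥
  clq C   ▷ vtx v   = v ∈ members G C
  clq C   ▷ clq _   = ⊥
  clq C   ▷ chn _ _ = ⊥
  chn o p ▷ vtx v   = v ∈ bottom o p
  chn o p ▷ clq C   = o ⊆ members G C
  chn o p ▷ chn b q = (o ∷ p) ▷ᶜ (b ∷ q)

  ▷ᶜ? : ∀ xs ys → Dec (xs ▷ᶜ ys)
  ▷ᶜ? []          _        = no λ ()
  ▷ᶜ? (d ∷ [])    _        = no λ { (there ()) }
  ▷ᶜ? (d ∷ c ∷ p) []       = map′ there (λ { (there r) → r }) (▷ᶜ? (c ∷ p) [])
  ▷ᶜ? (d ∷ c ∷ p) (b ∷ q)  = map′ join split
    ((List.≡-dec _≟ˢ_ q p ×-dec (c ⊆? b) ×-dec (b ⊆? d)) ⊎-dec ▷ᶜ? (c ∷ p) (b ∷ q))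
    where
    join : (q ≡ p × c ⊆ b × b ⊆ d) ⊎ ((c ∷ p) ▷ᶜ (b ∷ q)) → (d ∷ c ∷ p) ▷ᶜ (b ∷ q)
    join (inj₁ (refl , c⊆b , b⊆d)) = here c⊆b b⊆d
    join (inj₂ r)                  = there r

    split : (d ∷ c ∷ p) ▷ᶜ (b ∷ q) → (q ≡ p × c ⊆ b × b ⊆ d) ⊎ ((c ∷ p) ▷ᶜ (b ∷ q))
    split (here c⊆b b⊆d) = inj₁ (refl , c⊆b , b⊆d)
    split (there r)      = inj₂ r

  _▷?_ : ∀ a b → Dec (a ▷ b)
  vtx v   ▷? _       = no λ ()
  clq C   ▷? vtx v   = v ∈? members G C
  clq C   ▷? clq _   = no λ ()
  clq C   ▷? chn _ _ = no λ ()
  chn o p ▷? vtx v   = v ∈? bottom o p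
  chn o p ▷? clq C   = o ⊆? members G C
  chn o p ▷? chn b q = ▷ᶜ? (o ∷ p) (b ∷ q)

  ▷ᶜ⇒length< : ∀ {xs ys} → xs ▷ᶜ ys → length ys < length xs
  ▷ᶜ⇒length< (here _ _) = ℕ.≤-refl
  ▷ᶜ⇒length< (there r)  = ℕ.m≤n⇒m≤1+n (▷ᶜ⇒length< r)

  ▷⇒rank< : ∀ a b → a ▷ b → rank b < rank a
  ▷⇒rank< (clq _)   (vtx _)   _ = s≤s z≤n
  ▷⇒rank< (chn _ _) (vtx _)   _ = s≤s z≤n
  ▷⇒rank< (chn _ _) (clq _)   _ = s≤s (s≤s z≤n)
  ▷⇒rank< (chn _ _) (chn _ _) r = s≤s (▷ᶜ⇒length< r)

  -- Lower intervals contribute only shorter lists, so the length singles out the topmost interval.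
  ▷ᶜ-top : ∀ {d c b p q} → length q ≡ length p → (d ∷ c ∷ p) ▷ᶜ (b ∷ q) → q ≡ p × c ⊆ b × b ⊆ d
  ▷ᶜ-top _ (here c⊆b b⊆d) = refl , c⊆b , b⊆d
  ▷ᶜ-top e (there r)      = contradiction (cong suc e) (ℕ.<⇒≢ (▷ᶜ⇒length< r))

  bottom∈ : ∀ {o p} → Chain (o ∷ p) → IsIntersection (bottom o p)
  bottom∈ {p = []}    (o ∷ _ , _) = o
  bottom∈ {p = _ ∷ _} ch          = bottom∈ (chain-tail ch)

  -- Replacing `d` by the smaller set `b` only adds cliques, and replacing `c` by the larger set `b`
  -- only widens what is seen directly below: the interval ending in `c`, or the vertices of
  -- `O₁ = c` if `p` is empty.
  fan-▷ : ∀ {b c d p} → c ⊆ b → b ⊆ d → ∀ w → chn d (c ∷ p) ▷ w →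
          (∃ λ b′ → w ≡ chn b′ p × c ⊆ b′ × b′ ⊆ d) ⊎ chn b p ▷ w
  fan-▷ {p = []}    c⊆b b⊆d (vtx v) r = inj₂ (c⊆b r)
  fan-▷ {p = _ ∷ _} c⊆b b⊆d (vtx v) r = inj₂ r
  fan-▷ c⊆b b⊆d (clq C)   r                        = inj₂ (⊆-trans b⊆d r)
  fan-▷ c⊆b b⊆d (chn f q) (here c⊆f f⊆d)           = inj₁ (f , refl , c⊆f , f⊆d)
  fan-▷ c⊆b b⊆d (chn f q) (there (here e⊆f f⊆c))   = inj₂ (here e⊆f (⊆-trans f⊆c c⊆b))
  fan-▷ c⊆b b⊆d (chn f q) (there (there r))        = inj₂ (there r)

  -- Converse of `fan-▷`. The family `S` is abstract because it serves twice: for a full interval,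
  -- where `c` and `d` belong to `S`, and for an arbitrary `A`, where they are constructed as meet
  -- and join. If `w` lies in the interval just below every `b`, its upper bounds combine to `c`
  -- through `meet`.
  ▷-fan : ∀ {S : Pred (Subset n) 0ℓ} {b₀ c d p} → S b₀ →
          (∀ {v} → (∀ b → S b → v ∈ b) → v ∈ c) →
          (∀ {C} → (∀ b → S b → b ⊆ members G C) → d ⊆ members G C) →
          ∀ w → (∀ b → S b → chn b p ▷ w) → chn d (c ∷ p) ▷ w
  ▷-fan {p = []}    s meet join (vtx v) r = meet r
  ▷-fan {p = _ ∷ _} s meet join (vtx v) r = r _ s
  ▷-fan             s meet join (clq C) r = join r
  ▷-fan {S} {c = c}  s meet join (chn f q) r with r _ s
  ... | there r′   = there (there r′)
  ... | here e⊆f _ = there (here e⊆f (λ v∈f → meet (λ b sb → proj₂ (proj₂ (▷ᶜ-top refl (r b sb))) v∈f)))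

  -- The last entry is seen only by cliques and by the topmost interval, whose members have rank
  -- `2 + length q`; both are excluded.
  ▷-swap : ∀ {b b′ e q} w → rank w ≢ 1 → rank w ≤ suc (length q) →
           chn b (e ∷ q) ▷ w → chn b′ (e ∷ q) ▷ w
  ▷-swap (vtx v)   _  _ r          = r
  ▷-swap (clq C)   ≢1 _ _          = contradiction refl ≢1
  ▷-swap (chn f q) _  l (here _ _) = contradiction l ℕ.1+n≰n
  ▷-swap (chn f q) _  _ (there r)  = there r

  -- Total on nodes, so that meets such as `⋂[ A ] (head ∘ node)` make sense before the nodes in `A`
  -- are known to be chains. The value on cliques is the one needed for `k = 2`.
  head : Node → Subset n
  head (vtx v)   = ⁅ v ⁆
  head (clq C)   = members G C
  head (chn o _) = o

  tail : Node → List (Subset n)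
  tail (vtx _)   = []
  tail (clq _)   = []
  tail (chn _ p) = p

  rank≡0 : ∀ {w} → rank w ≡ 0 → ∃ λ v → w ≡ vtx v
  rank≡0 {vtx v} _ = v , refl

  rank≡1 : ∀ {w} → rank w ≡ 1 → ∃ λ C → w ≡ clq C
  rank≡1 {clq C} _ = C , refl

  rank≡2+ : ∀ {w} → rank w ≡ 2 + k → w ≡ chn (head w) (tail w) × length (tail w) ≡ k
  rank≡2+ {w = chn _ _} refl = refl , refl

  -- At this rank the first chain sees exactly the interval from `e` to `c` over `q`. Transferring
  -- its two ends puts them into the interval from `e′` to `c′` over `q′`.
  tail-determined : ∀ {b b′ c c′ e e′ q q′} → length q ≡ length q′ →
    Chain (b ∷ c ∷ e ∷ q) →
    (∀ w → Valid w → rank w ≡ 2 + length q → chn b (c ∷ e ∷ q) ▷ w → chn b′ (c′ ∷ e′ ∷ q′) ▷ w) →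
    q ≡ q′ × e′ ⊆ e × c ⊆ c′
  tail-determined {c = c} {e = e} {q = q} len ch f
    with f (chn e q) (chain-tail (chain-tail ch)) refl (there (here (λ v → v) e⊆c))
       | f (chn c q) (chain-skip (chain-tail ch)) refl (there (here e⊆c (λ v → v)))
    where
    e⊆c : e ⊆ c
    e⊆c = proj₁ (Linkedˡ.head (Linkedˡ.tail (proj₂ ch)))
  ... | here _ _ | _        = contradiction len (ℕ.1+n≢n)
  ... | there _  | here _ _ = contradiction len (ℕ.1+n≢n)
  ... | there r  | there r′ with refl , e′⊆e , _ ← ▷ᶜ-top len r | _ , _ , c⊆c′ ← ▷ᶜ-top len r′ =
    refl , e′⊆e , c⊆c′

  -- Graphs labelled by nodes

  record Model {i} (H : PartiteGraph (2 + i)) : Set where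
    open PartiteGraph H
    field
      node           : Vertex → Node
      node-injective : ∀ {x y} → node x ≡ node y → x ≡ y
      node-valid     : ∀ x → Valid (node x)
      rank-node      : ∀ x → rank (node x) ≡ toℕ (level x)
      -- Completeness is needed as well as correctness of the labels: the extreme chains of an
      -- interval must occur as vertices before inclusions of neighbourhoods say anything about
      -- them.
      vertexOf       : ∀ w → Valid w → rank w < 2 + i → ∃ λ x → node x ≡ w
      adj⇒▷          : ∀ {x y} → toℕ (level y) < toℕ (level x) → Adj x y → node x ▷ node y
      ▷⇒adj          : ∀ {x y} → node x ▷ node y → Adj x y

    ∈part⁺ : ∀ {x j} → rank (node x) ≡ j → x ∈ part j
    ∈part⁺ {x} {j} e = ∈⟦⟧⁺ (λ x → toℕ (level x) ℕ.≟ j) (trans (sym (rank-node x)) e)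

    ∈part⁻ : ∀ {x j} → x ∈ part j → rank (node x) ≡ j
    ∈part⁻ {x} {j} x∈ = trans (rank-node x) (∈⟦⟧⁻ (λ x → toℕ (level x) ℕ.≟ j) x∈)

    ∈N⁺ : ∀ {x y} → node x ▷ node y → y ∈ N x
    ∈N⁺ {x} r = ∈⟦⟧⁺ (x adj?_) (▷⇒adj r)

    ∈N⁻ : ∀ {x y} → x ∈ part (1 + i) → y ∈ N x → node x ▷ node y
    ∈N⁻ {x} {y} x∈ y∈ = adj⇒▷ (ℕ.≤∧≢⇒< y≤x (λ e → partite adj (Fin.toℕ-injective (sym e)))) adj
      where
      adj = ∈⟦⟧⁻ (x adj?_) y∈
      y≤x : toℕ (level y) ≤ toℕ (level x)
      y≤x = subst (toℕ (level y) ≤_) (trans (sym (∈part⁻ x∈)) (rank-node x)) (ℕ.≤-pred (Fin.toℕ<n (level y)))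

    ∈N[]⁺ : ∀ {x y j} → node x ▷ node y → rank (node y) ≡ j → y ∈ N[ j ] x
    ∈N[]⁺ r e = x∈p∩q⁺ (∈N⁺ r , ∈part⁺ e)

    ∈N[]⁻ : ∀ {x y j} → j < rank (node x) → y ∈ N[ j ] x → node x ▷ node y × rank (node y) ≡ j
    ∈N[]⁻ {x} {y} {j} j<x y∈ with y∈N , y∈j ← x∈p∩q⁻ (N x) (part j) y∈ =
      adj⇒▷ (subst (_< toℕ (level x)) (trans (sym (∈part⁻ y∈j)) (rank-node y))
                   (subst (j <_) (rank-node x) j<x))
            (∈⟦⟧⁻ (x adj?_) y∈N)
      , ∈part⁻ y∈j

    D : Subset n → List (Subset n) → Subset order
    D o p = ⟦ (λ y → chn o p ▷? node y) ⟧

    ∈D⁺ : ∀ {o p y} → chn o p ▷ node y → y ∈ D o p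
    ∈D⁺ {o} {p} = ∈⟦⟧⁺ (λ y → chn o p ▷? node y)

    ∈D⁻ : ∀ {o p y} → y ∈ D o p → chn o p ▷ node y
    ∈D⁻ {o} {p} = ∈⟦⟧⁻ (λ y → chn o p ▷? node y)

    -- `V*` tests `X ∩ V_{k-1}`, whereas `V⁺` supplies `A`. They agree because a neighbour of an
    -- element of the last level has smaller rank.
    ⋂N∩part : ∀ {A} → A ⊆ part (1 + i) → ∃ (_∈ A) → (A ∪ ⋂[ A ] N) ∩ part (1 + i) ≡ A
    ⋂N∩part {A} A⊆ (x , x∈A) = ⊆-antisym forth (λ y∈A → x∈p∩q⁺ (p⊆p∪q _ y∈A , A⊆ y∈A))
      where
      forth : (A ∪ ⋂[ A ] N) ∩ part (1 + i) ⊆ A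
      forth {y} y∈ with y∈∪ , y∈top ← x∈p∩q⁻ (A ∪ ⋂[ A ] N) (part (1 + i)) y∈ | x∈p∪q⁻ A (⋂[ A ] N) y∈∪
      ... | inj₁ y∈A = y∈A
      ... | inj₂ y∈⋂ = contradiction (trans (∈part⁻ y∈top) (sym (∈part⁻ (A⊆ x∈A))))
        (ℕ.<⇒≢ (▷⇒rank< _ _ (∈N⁻ (A⊆ x∈A) (∈⋂⁻ A y∈⋂ x∈A))))

  vtx-injective : ∀ {u v} → vtx u ≡ vtx v → u ≡ v
  vtx-injective refl = refl

  clq-injective : ∀ {C D} → clq C ≡ clq D → C ≡ D
  clq-injective refl = refl

  chn-injective : ∀ {o o′ p p′} → chn o p ≡ chn o′ p′ → o ≡ o′ × p ≡ p′
  chn-injective refl = refl , refl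

  module Realise {i} {H : PartiteGraph (2 + i)} (M : Model H) where
    open PartiteGraph H
    open Model M

    realise : ∀ {P : Pred Node 0ℓ} {w} → Valid w → rank w < 2 + i → P w →
              ∃ λ x → node x ≡ w × P (node x)
    realise {P} {w} v r pw with x , e ← vertexOf w v r = x , e , subst P (sym e) pw

    twoVertices⁺ : ∀ {P : Pred Node 0ℓ} → AtLeastTwo (P ∘ vtx) → AtLeastTwo (P ∘ node)
    twoVertices⁺ {P} = AtLeastTwo-map (λ v x → node x ≡ vtx v)
      (realise {P} tt (s≤s z≤n)) (λ e e′ → vtx-injective (trans (sym e) e′))

    twoCliques⁺ : ∀ {P : Pred Node 0ℓ} → AtLeastTwo (P ∘ clq) → AtLeastTwo (P ∘ node)
    twoCliques⁺ {P} = AtLeastTwo-map (λ C x → node x ≡ clq C)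
      (realise {P} tt (s≤s (s≤s z≤n))) (λ e e′ → clq-injective (trans (sym e) e′))

    twoVertices⁻ : ∀ {P : Pred Node 0ℓ} {Q : Pred (Fin n) 0ℓ} → (∀ {w} → P w → rank w ≡ 0) →
                   (∀ {v} → P (vtx v) → Q v) → AtLeastTwo (P ∘ node) → AtLeastTwo Q
    twoVertices⁻ {P} {Q} r f = AtLeastTwo-map (λ x v → node x ≡ vtx v)
      (λ px → let v , e = rank≡0 (r px) in v , e , f (subst P e px))
      (λ e e′ → node-injective (trans e (sym e′)))

    twoCliques⁻ : ∀ {P : Pred Node 0ℓ} {Q : Pred (𝒦 G) 0ℓ} → (∀ {w} → P w → rank w ≡ 1) →
                  (∀ {C} → P (clq C) → Q C) → AtLeastTwo (P ∘ node) → AtLeastTwo Q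
    twoCliques⁻ {P} {Q} r f = AtLeastTwo-map (λ x C → node x ≡ clq C)
      (λ px → let C , e = rank≡1 (r px) in C , e , f (subst P e px))
      (λ e e′ → node-injective (trans e (sym e′)))

  -- What one factorisation step has to provide

  record Step {i} (H : PartiteGraph (2 + i)) (M : Model H) : Set where
    open Model M
    field
      D∈V*        : ∀ {o p} → Chain (o ∷ p) → length p ≡ i → V* H (D o p)
      D-cofinal   : ∀ {X} → V* H X → ∃₂ λ o p → Chain (o ∷ p) × length p ≡ i × X ⊆ D o p
      -- Assuming an inclusion rather than an equality makes the sets `D` an antichain, which their
      -- maximality rests on.
      D-injective : ∀ {o p o′ p′} → Chain (o ∷ p) → length p ≡ i → Chain (o′ ∷ p′) → length p′ ≡ i →
                    D o p ⊆ D o′ p′ → o ≡ o′ × p ≡ p′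

  -- The step for `k = 2`

  module First (H : PartiteGraph 2) (M : Model H) where
    open PartiteGraph H
    open Model M
    open Realise M

    -- The cliques containing `o` serve as `A`; closedness of `o` turns their common neighbours into
    -- exactly the vertices in `o`.
    D₀∈V* : ∀ {o} → IsIntersection o → V* H (D o [])
    D₀∈V* {o} o∈ =
      (A , (λ x∈ → proj₂ (x∈p∩q⁻ (D o []) (part 1) x∈)) , 2≤∣∣⁺ twoA , 2≤∣∣⁺ two⋂ , ⊆-antisym forth back) , tt
      where
      A : Subset order
      A = D o [] ∩ part 1

      A⁻ : ∀ {x} → x ∈ A → ∃ λ C → node x ≡ clq C × o ⊆ members G C
      A⁻ {x} x∈A with x∈D , x∈1 ← x∈p∩q⁻ (D o []) (part 1) x∈A with C , e ← rank≡1 (∈part⁻ x∈1) =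
        C , e , subst (chn o [] ▷_) e (∈D⁻ x∈D)

      twoA : AtLeastTwo (_∈ A)
      twoA with x , y , x≢y , (x∈ , rx) , (y∈ , ry) ←
        twoCliques⁺ {λ w → chn o [] ▷ w × rank w ≡ 1}
          (let C , D , ne , o⊆C , o⊆D = twoCliques o∈ in C , D , ne , (o⊆C , refl) , (o⊆D , refl)) =
        x , y , x≢y , x∈p∩q⁺ (∈D⁺ x∈ , ∈part⁺ rx) , x∈p∩q⁺ (∈D⁺ y∈ , ∈part⁺ ry)

      below : ∀ w → chn o [] ▷ w → ∀ {C} → o ⊆ members G C → (rank w ≡ 1) ⊎ (clq C ▷ w)
      below (vtx v)   r o⊆C = inj₂ (o⊆C r)
      below (clq _)   r o⊆C = inj₁ refl
      below (chn _ _) (there ()) _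

      ⋂⁺ : ∀ {y} → chn o [] ▷ node y → rank (node y) ≢ 1 → y ∈ ⋂[ A ] N
      ⋂⁺ {y} r ≢1 = ∈⋂⁺ A λ {x} x∈A → helper (A⁻ x∈A)
        where
        helper : ∀ {x} → (∃ λ C → node x ≡ clq C × o ⊆ members G C) → y ∈ N x
        helper (C , e , o⊆C) with below (node y) r o⊆C
        ... | inj₁ ≡1 = contradiction ≡1 ≢1
        ... | inj₂ r′ = ∈N⁺ (subst (_▷ node y) (sym e) r′)

      two⋂ : AtLeastTwo (_∈ ⋂[ A ] N)
      two⋂ with x , y , x≢y , (x∈ , rx) , (y∈ , ry) ←
        twoVertices⁺ {λ w → chn o [] ▷ w × rank w ≢ 1}
          (let u , v , ne , u∈o , v∈o = twoVertices o∈ in u , v , ne , (u∈o , λ ()) , (v∈o , λ ())) =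
        x , y , x≢y , ⋂⁺ x∈ rx , ⋂⁺ y∈ ry

      forth : D o [] ⊆ A ∪ ⋂[ A ] N
      forth {y} y∈ with rank (node y) ℕ.≟ 1
      ... | yes e = p⊆p∪q _ (x∈p∩q⁺ (y∈ , ∈part⁺ e))
      ... | no ne = q⊆p∪q A _ (⋂⁺ (∈D⁻ y∈) ne)

      ⋂⁻ : ∀ w → (∀ {x} → x ∈ A → node x ▷ w) → chn o [] ▷ w
      -- One clique from `A` is needed to see that `w` is a vertex of `G`: a clique has no other
      -- nodes below it.
      ⋂⁻ w f with x , _ , _ , x∈A , _ ← twoA with C , e , _ ← A⁻ x∈A with subst (_▷ w) e (f x∈A)
      ⋂⁻ (vtx v) f | _ = closed o∈ λ C o⊆C →
        let x , e , rx , r = realise {λ w → rank w ≡ 1 × chn o [] ▷ w} {clq C}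
              tt (s≤s (s≤s z≤n)) (refl , λ {_} → o⊆C)
        in subst (_▷ vtx v) e (f (x∈p∩q⁺ (∈D⁺ r , ∈part⁺ rx)))

      back : A ∪ ⋂[ A ] N ⊆ D o []
      back {y} y∈ with x∈p∪q⁻ A (⋂[ A ] N) y∈
      ... | inj₁ y∈A = proj₁ (x∈p∩q⁻ (D o []) (part 1) y∈A)
      ... | inj₂ y∈⋂ = ∈D⁺ (⋂⁻ (node y) λ x∈A →
        ∈N⁻ (proj₂ (x∈p∩q⁻ (D o []) (part 1) x∈A)) (∈⋂⁻ A y∈⋂ x∈A))

    -- With `o` the intersection of the cliques in `A`, the common neighbours of `A` are vertices in
    -- `o`. So the two cardinality bounds in `V⁺` give the two vertices and the two cliques required
    -- of `o`.
    D₀-cofinal : ∀ {X} → V* H X → ∃ λ o → IsIntersection o × X ⊆ D o []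
    D₀-cofinal ((A , A⊆ , 2≤A , 2≤⋂ , refl) , _) = o , o∈ , X⊆
      where
      o : Subset n
      o = ⋂[ A ] (head ∘ node)

      A-clq : ∀ {x} → x ∈ A → ∃ λ C → node x ≡ clq C
      A-clq x∈A = rank≡1 (∈part⁻ (A⊆ x∈A))

      o⊆ : ∀ {x C} → x ∈ A → node x ≡ clq C → o ⊆ members G C
      o⊆ {x} x∈A e {v} v∈o = subst (λ w → v ∈ head w) e (∈⋂⁻ A v∈o x∈A)

      ⋂⇒vtx : ∀ {y} → y ∈ ⋂[ A ] N → ∃ λ v → node y ≡ vtx v × v ∈ o
      ⋂⇒vtx {y} y∈⋂ with x , _ , _ , x∈A , _ ← 2≤∣∣⁻ 2≤A with C , e ← A-clq x∈A =
        helper (node y) refl (subst (_▷ node y) e (∈N⁻ (A⊆ x∈A) (∈⋂⁻ A y∈⋂ x∈A)))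
        where
        helper : ∀ w → node y ≡ w → clq C ▷ w → ∃ λ v → node y ≡ vtx v × v ∈ o
        helper (vtx v) e _ = v , e , ∈⋂⁺ A λ {x′} x′∈A →
          let C′ , e′ = A-clq x′∈A
          in subst (λ w → v ∈ head w) (sym e′)
               (subst (_▷ vtx v) e′ (subst (node x′ ▷_) e (∈N⁻ (A⊆ x′∈A) (∈⋂⁻ A y∈⋂ x′∈A))))

      o∈ : IsIntersection o
      o∈ = record
        { twoVertices = AtLeastTwo-map (λ y v → node y ≡ vtx v) ⋂⇒vtx
            (λ e e′ → node-injective (trans e (sym e′))) (2≤∣∣⁻ 2≤⋂)
        ; twoCliques = AtLeastTwo-map (λ x C → node x ≡ clq C)
            (λ x∈A → let C , e = A-clq x∈A in C , e , λ {_} → o⊆ x∈A e)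
            (λ e e′ → node-injective (trans e (sym e′))) (2≤∣∣⁻ 2≤A)
        ; closed = λ {v} f → ∈⋂⁺ A λ x∈A →
            let C , e = A-clq x∈A in subst (λ w → v ∈ head w) (sym e) (f C (o⊆ x∈A e))
        }

      X⊆ : A ∪ ⋂[ A ] N ⊆ D o []
      X⊆ {y} y∈ with x∈p∪q⁻ A (⋂[ A ] N) y∈
      ... | inj₁ y∈A with C , e ← A-clq y∈A = ∈D⁺ (subst (chn o [] ▷_) (sym e) (λ {_} → o⊆ y∈A e))
      ... | inj₂ y∈⋂ with v , e , v∈o ← ⋂⇒vtx y∈⋂ = ∈D⁺ (subst (chn o [] ▷_) (sym e) v∈o)

    -- Vertices give one inclusion. Cliques give the other, since every clique containing `o` also
    -- contains `o′`.
    D₀-injective : ∀ {o o′} → IsIntersection o → D o [] ⊆ D o′ [] → o ≡ o′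
    D₀-injective {o} {o′} o∈ D⊆ = ⊆-antisym
      (λ {v} → transport (vtx v) tt (s≤s z≤n))
      (antitone o∈ λ C → transport (clq C) tt (s≤s (s≤s z≤n)))
      where
      transport : ∀ w → Valid w → rank w < 2 → chn o [] ▷ w → chn o′ [] ▷ w
      transport w v l r with x , e , r′ ← realise {chn o [] ▷_} {w} v l r =
        subst (chn o′ [] ▷_) e (∈D⁻ (D⊆ (∈D⁺ r′)))

    step : Step H M
    step = record
      { D∈V*        = λ { {p = []} (o∈ ∷ [] , _) refl → D₀∈V* o∈ }
      ; D-cofinal   = λ x → let o , o∈ , X⊆ = D₀-cofinal x in o , [] , (o∈ ∷ [] , [-]) , refl , λ {_} → X⊆
      ; D-injective = λ { {p = []} {p′ = []} (o∈ ∷ [] , _) refl _ refl D⊆ → D₀-injective o∈ D⊆ , refl }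
      }

  -- The step for `k ≥ 3`

  module Later {i} (H : PartiteGraph (3 + i)) (M : Model H) where
    open PartiteGraph H
    open Model M
    open Realise M

    node-top : ∀ {x} → x ∈ part (2 + i) →
               node x ≡ chn (head (node x)) (tail (node x)) × length (tail (node x)) ≡ i
    node-top x∈ = rank≡2+ (∈part⁻ x∈)

    -- Here `A` consists of the chains `chn b p` with `b` between `c` and `d`. Its members `chn c p`
    -- and `chn d p` alone already determine which nodes are below all of `A`.
    module Interval {c d p} (ch : Chain (d ∷ c ∷ p)) (len : length p ≡ i) where

      c⊂d : c ⊂ d
      c⊂d = Linkedˡ.head (proj₂ ch)

      A : Subset order
      A = D d (c ∷ p) ∩ part (2 + i)

      A⊆D : A ⊆ D d (c ∷ p)
      A⊆D x∈A = proj₁ (x∈p∩q⁻ (D d (c ∷ p)) (part (2 + i)) x∈A)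

      A⊆part : A ⊆ part (2 + i)
      A⊆part x∈A = proj₂ (x∈p∩q⁻ (D d (c ∷ p)) (part (2 + i)) x∈A)

      A⁻ : ∀ {x} → x ∈ A → node x ≡ chn (head (node x)) p × c ⊆ head (node x) × head (node x) ⊆ d
      A⁻ {x} x∈A with e , l ← node-top (A⊆part x∈A)
        with tail≡p , c⊆b , b⊆d ← ▷ᶜ-top (trans l (sym len)) (subst (chn d (c ∷ p) ▷_) e (∈D⁻ (A⊆D x∈A))) =
        trans e (cong (chn _) tail≡p) , c⊆b , b⊆d

      A⁺ : ∀ {b} → Chain (b ∷ p) → c ⊆ b → b ⊆ d → ∃ λ x → node x ≡ chn b p × x ∈ A
      A⁺ {b} ch′ c⊆b b⊆d
        with x , e , r , rx ← realise {λ w → (chn d (c ∷ p) ▷ w) × rank w ≡ 2 + i} {chn b p} ch′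
          (s≤s (s≤s (s≤s (ℕ.≤-reflexive len)))) (here c⊆b b⊆d , cong (2 +_) len) =
        x , e , x∈p∩q⁺ (∈D⁺ r , ∈part⁺ rx)

      least : ∃ λ x → node x ≡ chn c p × x ∈ A
      least = A⁺ (chain-tail ch) (λ v∈ → v∈) (proj₁ c⊂d)

      greatest : ∃ λ x → node x ≡ chn d p × x ∈ A
      greatest = A⁺ (chain-skip ch) (proj₁ c⊂d) (λ v∈ → v∈)

      twoA : AtLeastTwo (_∈ A)
      twoA with x , e , x∈A ← least with y , e′ , y∈A ← greatest =
        x , y , (λ { refl → ⊂⇒≢ c⊂d (proj₁ (chn-injective (trans (sym e) e′))) }) , x∈A , y∈A

      ⊆N : ∀ {x y} → x ∈ A → chn d (c ∷ p) ▷ node y → rank (node y) ≢ 2 + i → node x ▷ node y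
      ⊆N {x} {y} x∈A r ≢top with e , c⊆b , b⊆d ← A⁻ x∈A with fan-▷ c⊆b b⊆d (node y) r
      ... | inj₁ (_ , e′ , _) = contradiction (trans (cong rank e′) (cong (2 +_) len)) ≢top
      ... | inj₂ r′           = subst (_▷ node y) (sym e) r′

      D≡A∪⋂ : D d (c ∷ p) ≡ A ∪ ⋂[ A ] N
      D≡A∪⋂ = ⊆-antisym forth back
        where
        forth : D d (c ∷ p) ⊆ A ∪ ⋂[ A ] N
        forth {y} y∈ with rank (node y) ℕ.≟ 2 + i
        ... | yes e = p⊆p∪q _ (x∈p∩q⁺ (y∈ , ∈part⁺ e))
        ... | no ne = q⊆p∪q A _ (∈⋂⁺ A λ x∈A → ∈N⁺ (⊆N x∈A (∈D⁻ y∈) ne))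

        back : A ∪ ⋂[ A ] N ⊆ D d (c ∷ p)
        back {y} y∈ with x∈p∪q⁻ A (⋂[ A ] N) y∈
        ... | inj₁ y∈A = A⊆D y∈A
        ... | inj₂ y∈⋂ with x , e , x∈A ← least with x′ , e′ , x′∈A ← greatest =
          -- Both ends of the interval belong to `S`, so the conditions on meet and join are met by
          -- evaluating at `c` and at `d`.
          ∈D⁺ (▷-fan {S = S} {d = d} (x , x∈A , e)
            (λ f → f c (x , x∈A , e)) (λ f → f d (x′ , x′∈A , e′)) (node y)
            (λ { b (x , x∈A , e) → subst (_▷ node y) e (∈N⁻ (A⊆part x∈A) (∈⋂⁻ A y∈⋂ x∈A)) }))
          where
          S : Pred (Subset n) 0ℓ
          S b = ∃ λ x → x ∈ A × node x ≡ chn b p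

      common : ∀ j → j ≢ 2 + i → AtLeastTwo (λ y → chn d (c ∷ p) ▷ node y × rank (node y) ≡ j) →
               CommonNeighbours≥2 H j A
      common j ne (x , y , x≢y , (rx , refl) , (ry , ey)) = 2≤∣∣⁺
        ( x , y , x≢y
        , ∈⋂⁺ A (λ z∈A → ∈N[]⁺ (⊆N z∈A rx ne) refl)
        , ∈⋂⁺ A (λ z∈A → ∈N[]⁺ (⊆N z∈A ry (λ e → ne (trans (sym ey) e))) ey))

      lowVertices : AtLeastTwo (λ y → chn d (c ∷ p) ▷ node y × rank (node y) ≡ 0)
      lowVertices = twoVertices⁺ {λ w → chn d (c ∷ p) ▷ w × rank w ≡ 0}
        (let u , v , ne , u∈ , v∈ = twoVertices (bottom∈ ch) in u , v , ne , (u∈ , refl) , (v∈ , refl))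

      lowCliques : AtLeastTwo (λ y → chn d (c ∷ p) ▷ node y × rank (node y) ≡ 1)
      lowCliques = twoCliques⁺ {λ w → chn d (c ∷ p) ▷ w × rank w ≡ 1}
        (let C , C′ , ne , d⊆C , d⊆C′ = twoCliques (Allˡ.head (proj₁ ch))
         in C , C′ , ne , (d⊆C , refl) , (d⊆C′ , refl))

      two⋂ : AtLeastTwo (_∈ ⋂[ A ] N)
      two⋂ with x , y , x≢y , (rx , ex) , (ry , ey) ← lowVertices =
        x , y , x≢y
        , ∈⋂⁺ A (λ z∈A → ∈N⁺ (⊆N z∈A rx (λ e → ℕ.0≢1+n (trans (sym ex) e))))
        , ∈⋂⁺ A (λ z∈A → ∈N⁺ (⊆N z∈A ry (λ e → ℕ.0≢1+n (trans (sym ey) e))))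

    -- The second interval from the top, from `e` to `c`, is seen by every element of the fan, and
    -- its ends differ because the chain is strict.
    lowChains : ∀ {c d e q} → Chain (d ∷ c ∷ e ∷ q) → suc (length q) ≡ i →
                AtLeastTwo (λ y → chn d (c ∷ e ∷ q) ▷ node y × rank (node y) ≡ suc i)
    lowChains {c} {d} {e} {q} ch refl =
      let x , ex , px = realise {P} {chn e q} (chain-tail (chain-tail ch)) (s≤s (s≤s (s≤s (ℕ.n≤1+n _))))
            (there (here (λ v → v) (proj₁ e⊂c)) , refl)
          y , ey , py = realise {P} {chn c q} (chain-skip (chain-tail ch)) (s≤s (s≤s (s≤s (ℕ.n≤1+n _))))
            (there (here (proj₁ e⊂c) (λ v → v)) , refl)
      in x , y , (λ x≡y → ⊂⇒≢ e⊂c (proj₁ (chn-injective (trans (sym ex) (trans (cong node x≡y) ey))))) , px , py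
      where
      e⊂c : e ⊂ c
      e⊂c = Linkedˡ.head (Linkedˡ.tail (proj₂ ch))
      P : Pred Node 0ℓ
      P w = chn d (c ∷ e ∷ q) ▷ w × rank w ≡ suc i

    -- Elements of `A` differ only in their last entry, which no level up to `V_{k-3}` shows except
    -- `V₁`; hence the two restrictions on `j`.
    same : ∀ {c d e q} (ch : Chain (d ∷ c ∷ e ∷ q)) (len : suc (length q) ≡ i) →
           ∀ j → j ≢ 1 → j ≤ suc (length q) → SameNeighbours H j (Interval.A ch len)
    same {c} {d} {e} {q} ch len j ≢1 j≤ x x∈A y y∈A = ⊆-antisym (half x∈A y∈A) (half y∈A x∈A)
      where
      open Interval ch len
      half : ∀ {x y} → x ∈ A → y ∈ A → N[ j ] x ⊆ N[ j ] y
      half {x} {y} x∈A y∈A {z} z∈ with ex , _ ← A⁻ x∈A with ey , _ ← A⁻ y∈A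
        with r , rz ← ∈N[]⁻ (subst (λ w → j < rank w) (sym ex) (s≤s (ℕ.m≤n⇒m≤1+n j≤))) z∈ =
        ∈N[]⁺ (subst (_▷ node z) (sym ey)
          (▷-swap (node z) (λ e → ≢1 (trans (sym rz) e)) (subst (_≤ _) (sym rz) j≤)
            (subst (_▷ node z) ex r))) rz

    -- Transferring `chn c p` and `chn d p` identifies the tails and yields `c′ ⊆ c` and `d ⊆ d′`.
    -- The cliques containing `d` yield `d′ ⊆ d`. For `c ⊆ c′` one looks one level deeper: at the
    -- upper end `chn c q` of the next interval, or at the vertices in `c` when `c` is `O₁`.
    D-injectiveˢ : ∀ {c c′ d d′ p p′} → Chain (d ∷ c ∷ p) → length p ≡ i →
                   Chain (d′ ∷ c′ ∷ p′) → length p′ ≡ i →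
                   D d (c ∷ p) ⊆ D d′ (c′ ∷ p′) → d ≡ d′ × c ∷ p ≡ c′ ∷ p′
    D-injectiveˢ {c} {c′} {d} {d′} {p} {p′} ch len ch′ len′ D⊆
      with ▷ᶜ-top (trans len (sym len′))
             (transport (chn c p) (chain-tail ch) (s≤s (s≤s (s≤s (ℕ.≤-reflexive len)))) (here (λ v → v) c⊆d))
         | ▷ᶜ-top (trans len (sym len′))
             (transport (chn d p) (chain-skip ch) (s≤s (s≤s (s≤s (ℕ.≤-reflexive len)))) (here c⊆d (λ v → v)))
      where
      c⊆d : c ⊆ d
      c⊆d = proj₁ (Linkedˡ.head (proj₂ ch))
      transport : ∀ w → Valid w → rank w < 3 + i → chn d (c ∷ p) ▷ w → chn d′ (c′ ∷ p′) ▷ w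
      transport w v l r with x , e , r′ ← realise {chn d (c ∷ p) ▷_} {w} v l r =
        subst (chn d′ (c′ ∷ p′) ▷_) e (∈D⁻ (D⊆ (∈D⁺ r′)))
    ... | refl , c′⊆c , _ | _ , _ , d⊆d′ =
      ⊆-antisym d⊆d′ (antitone (Allˡ.head (proj₁ ch)) λ C → transport′ (clq C) tt (s≤s (s≤s z≤n)))
      , cong (_∷ p) (⊆-antisym (c⊆c′ p ch len transport′) c′⊆c)
      where
      transport′ : ∀ w → Valid w → rank w < 3 + i → chn d (c ∷ p) ▷ w → chn d′ (c′ ∷ p) ▷ w
      transport′ w v l r with x , e , r′ ← realise {chn d (c ∷ p) ▷_} {w} v l r =
        subst (chn d′ (c′ ∷ p) ▷_) e (∈D⁻ (D⊆ (∈D⁺ r′)))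
      c⊆c′ : ∀ p → Chain (d ∷ c ∷ p) → length p ≡ i →
             (∀ w → Valid w → rank w < 3 + i → chn d (c ∷ p) ▷ w → chn d′ (c′ ∷ p) ▷ w) → c ⊆ c′
      c⊆c′ []      ch len f {v} = f (vtx v) tt (s≤s z≤n)
      c⊆c′ (e ∷ q) ch len f
        with f (chn c q) (chain-skip (chain-tail ch))
               (s≤s (s≤s (s≤s (ℕ.≤-trans (ℕ.n≤1+n _) (ℕ.≤-reflexive len)))))
               (there (here (proj₁ (Linkedˡ.head (Linkedˡ.tail (proj₂ ch)))) (λ v → v)))
      ... | there r = proj₂ (proj₂ (▷ᶜ-top refl r))

    same⇒ : ∀ {A j} → A ⊆ part (2 + i) → SameNeighbours H j A → j < 2 + i →
            ∀ {x y} → x ∈ A → y ∈ A → ∀ w → Valid w → rank w ≡ j → node x ▷ w → node y ▷ w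
    same⇒ {j = j} A⊆ sm j< {x} {y} x∈A y∈A w v rw r
      with z , e , r′ , rz ← realise {λ w → node x ▷ w × rank w ≡ j} {w} v
             (subst (_< 3 + i) (sym rw) (ℕ.m≤n⇒m≤1+n j<)) (r , rw) =
      subst (node y ▷_) e (proj₁ (∈N[]⁻ (subst (j <_) (sym (∈part⁻ (A⊆ y∈A))) j<)
        (subst (z ∈_) (sm x x∈A y y∈A) (∈N[]⁺ r′ rz))))

    Below : Subset order → ℕ → Pred Node 0ℓ
    Below A j w = rank w ≡ j × (∀ {x} → x ∈ A → node x ▷ w)

    common⁻ : ∀ {A j} → A ⊆ part (2 + i) → ∃ (_∈ A) → j < 2 + i →
              CommonNeighbours≥2 H j A → AtLeastTwo (Below A j ∘ node)
    common⁻ {A} {j} A⊆ (x₀ , x₀∈A) j< 2≤ with y , z , y≢z , y∈ , z∈ ← 2≤∣∣⁻ 2≤ =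
      y , z , y≢z , below y∈ , below z∈
      where
      N⁻ : ∀ {x y} → x ∈ A → y ∈ N[ j ] x → node x ▷ node y × rank (node y) ≡ j
      N⁻ x∈A = ∈N[]⁻ (subst (j <_) (sym (∈part⁻ (A⊆ x∈A))) j<)
      below : ∀ {y} → y ∈ ⋂[ A ] N[ j ] → Below A j (node y)
      below y∈ = proj₂ (N⁻ x₀∈A (∈⋂⁻ A y∈ x₀∈A)) , λ x∈A → proj₁ (N⁻ x∈A (∈⋂⁻ A y∈ x∈A))

    -- `c` and `d` are the meet and the join of the last entries in the lattice `𝒪′`, hence the
    -- tightest interval holding them all.
    module Fan {A} (A⊆ : A ⊆ part (2 + i)) (2≤A : 2 ≤ ∣ A ∣) {p}
               (node≡ : ∀ {x} → x ∈ A → node x ≡ chn (head (node x)) p) where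

      h : Vertex → Subset n
      h x = head (node x)

      c d : Subset n
      c = ⋂[ A ] h
      d = ⋂[ ⋂[ A ] (K G ∘ h) ] (members G)

      nonempty : ∃ (_∈ A)
      nonempty with x , _ , _ , x∈A , _ ← 2≤∣∣⁻ 2≤A = x , x∈A

      chain : ∀ {x} → x ∈ A → Chain (h x ∷ p)
      chain {x} x∈A = subst Valid (node≡ x∈A) (node-valid x)

      c⊆h : ∀ {x} → x ∈ A → c ⊆ h x
      c⊆h x∈A v∈c = ∈⋂⁻ A v∈c x∈A

      h⊆d : ∀ {x} → x ∈ A → h x ⊆ d
      h⊆d x∈A v∈h = ∈⋂⁺ (⋂[ A ] (K G ∘ h)) (λ C∈ → K⁻ (∈⋂⁻ A C∈ x∈A) v∈h)

      d⊆ : ∀ {C} → (∀ {x} → x ∈ A → h x ⊆ members G C) → d ⊆ members G C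
      d⊆ f v∈d = ∈⋂⁻ (⋂[ A ] (K G ∘ h)) v∈d (∈⋂⁺ A (λ x∈A → K⁺ (f x∈A)))

      -- Closedness and the two cliques are inherited from the entries above `c`. The two vertices
      -- may be lost in a meet, so they are asked for; their origin depends on `k`.
      c-intersection : AtLeastTwo (_∈ c) → IsIntersection c
      c-intersection two = record
        { twoVertices = two
        ; twoCliques  = let x , x∈A = nonempty
                            C , D , ne , ⊆C , ⊆D = twoCliques (Allˡ.head (proj₁ (chain x∈A)))
                        in C , D , ne , (λ v∈ → ⊆C (c⊆h x∈A v∈)) , (λ v∈ → ⊆D (c⊆h x∈A v∈))
        ; closed      = λ f → ∈⋂⁺ A λ x∈A →
            closed (Allˡ.head (proj₁ (chain x∈A))) (λ C h⊆C → f C (λ v∈ → h⊆C (c⊆h x∈A v∈)))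
        }

      module _ (2≤C : CommonNeighbours≥2 H 1 A) where

        d-intersection : IsIntersection d
        d-intersection = record
          { twoVertices = let x , x∈A = nonempty
                              u , v , ne , u∈ , v∈ = twoVertices (Allˡ.head (proj₁ (chain x∈A)))
                          in u , v , ne , h⊆d x∈A u∈ , h⊆d x∈A v∈
          ; twoCliques  = twoCliques⁻ {Below A 1} {λ C → d ⊆ members G C} proj₁
              (λ {C} b → d⊆ (λ x∈A → subst (_▷ clq C) (node≡ x∈A) (proj₂ b x∈A)))
              (common⁻ A⊆ nonempty (s≤s (s≤s z≤n)) 2≤C)
          ; closed      = λ f → ∈⋂⁺ (⋂[ A ] (K G ∘ h)) (λ {C} C∈ → f C (d⊆ (λ x∈A → K⁻ (∈⋂⁻ A C∈ x∈A))))
          }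

        -- If the bounds coincided, all last entries would be equal; but two distinct vertices in
        -- `A` share the tail `p` and must differ there.
        c⊂d : c ⊂ d
        c⊂d = ⊆∧≢⇒⊂ (λ v∈ → let x , x∈A = nonempty in h⊆d x∈A (c⊆h x∈A v∈)) λ c≡d →
          let x , y , x≢y , x∈A , y∈A = 2≤∣∣⁻ 2≤A
              h≡c : ∀ {x} → x ∈ A → h x ≡ c
              h≡c = λ {x} x∈A → ⊆-antisym (subst (h x ⊆_) (sym c≡d) (h⊆d x∈A)) (c⊆h x∈A)
          in x≢y (node-injective (trans (node≡ x∈A)
               (trans (cong (λ b → chn b p) (trans (h≡c x∈A) (sym (h≡c y∈A)))) (sym (node≡ y∈A)))))

        cofinal : Chain (c ∷ p) → Chain (d ∷ c ∷ p) × A ∪ ⋂[ A ] N ⊆ D d (c ∷ p)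
        cofinal (os , ls) = (d-intersection ∷ os , c⊂d ∷ ls) , X⊆
          where
          S : Pred (Subset n) 0ℓ
          S b = ∃ λ x → x ∈ A × h x ≡ b

          A⊆D : ∀ {y} → y ∈ A → chn d (c ∷ p) ▷ node y
          A⊆D y∈A = subst (chn d (c ∷ p) ▷_) (sym (node≡ y∈A)) (here (c⊆h y∈A) (h⊆d y∈A))

          ⋂⊆D : ∀ {y} → y ∈ ⋂[ A ] N → chn d (c ∷ p) ▷ node y
          ⋂⊆D {y} y∈⋂ = let x₀ , x₀∈A = nonempty in ▷-fan {S = S} {c = c} {d = d} (x₀ , x₀∈A , refl)
            (λ f → ∈⋂⁺ A (λ x∈A → f _ (_ , x∈A , refl)))
            (λ f → d⊆ (λ x∈A → f _ (_ , x∈A , refl)))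
            (node y)
            (λ { _ (x , x∈A , refl) → subst (_▷ node y) (node≡ x∈A) (∈N⁻ (A⊆ x∈A) (∈⋂⁻ A y∈⋂ x∈A)) })

          X⊆ : A ∪ ⋂[ A ] N ⊆ D d (c ∷ p)
          X⊆ y∈ = ∈D⁺ ([ A⊆D , ⋂⊆D ]′ (x∈p∪q⁻ A (⋂[ A ] N) y∈))

  -- The clean conditions for `k = 3`, `k = 4` and `k ≥ 5`

  clean : ∀ i (H : PartiteGraph (3 + i)) (M : Model H) {c d p} (ch : Chain (d ∷ c ∷ p)) (len : length p ≡ i) →
          CleanCondition (suc i) H (Later.Interval.A H M ch len)
  clean 0 H M ch len =
    common 1 (λ ()) lowCliques , common 0 (λ ()) lowVertices
    where open Later.Interval H M ch len
  clean 1 H M {p = _ ∷ _} ch len =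
    common 2 (λ ()) (Later.lowChains H M ch len) , common 1 (λ ()) lowCliques ,
    Later.same H M ch len 0 (λ ()) z≤n
    where open Later.Interval H M ch len
  clean (suc (suc i)) H M {p = _ ∷ _} ch len =
    common (3 + i) (ℕ.1+n≢n ∘ sym) (Later.lowChains H M ch len) ,
    Later.same H M ch len (2 + i) (λ ()) (ℕ.≤-reflexive (sym len)) ,
    common 1 (λ ()) lowCliques
    where open Later.Interval H M ch len

  clean⇒common₁ : ∀ i (H : PartiteGraph (3 + i)) {A} → CleanCondition (suc i) H A → CommonNeighbours≥2 H 1 A
  clean⇒common₁ 0             H (p , _)     = p
  clean⇒common₁ 1             H (_ , p , _) = p
  clean⇒common₁ (suc (suc i)) H (_ , _ , p) = p

  clean⇒common₂₊ : ∀ i (H : PartiteGraph (4 + i)) {A} → CleanCondition (2 + i) H A →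
                   CommonNeighbours≥2 H (2 + i) A
  clean⇒common₂₊ 0       H (p , _) = p
  clean⇒common₂₊ (suc i) H (p , _) = p

  tail-equal₀ : ∀ a b → rank a ≡ 2 → rank b ≡ 2 → tail a ≡ tail b
  tail-equal₀ (chn _ []) (chn _ []) _ _ = refl

  tail-equal₁ : ∀ a b → rank a ≡ 3 → rank b ≡ 3 → (∀ v → a ▷ vtx v → b ▷ vtx v) →
                (∀ v → b ▷ vtx v → a ▷ vtx v) → tail a ≡ tail b
  tail-equal₁ (chn _ (_ ∷ [])) (chn _ (_ ∷ [])) _ _ f g =
    cong (_∷ []) (⊆-antisym (λ {v} → f v) (λ {v} → g v))

  -- `tail-determined` gives only one inclusion at each end of the interval, so it is applied in
  -- both directions.
  tail-equal₂₊ : ∀ a b → Valid a → Valid b → rank a ≡ 4 + k → rank b ≡ 4 + k →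
                 (∀ w → Valid w → rank w ≡ 2 + k → a ▷ w → b ▷ w) →
                 (∀ w → Valid w → rank w ≡ 2 + k → b ▷ w → a ▷ w) → tail a ≡ tail b
  tail-equal₂₊ (chn _ (_ ∷ _ ∷ q)) (chn _ (_ ∷ _ ∷ q′)) va vb refl eb f g
    with len ← ℕ.suc-injective (ℕ.suc-injective (ℕ.suc-injective (ℕ.suc-injective eb)))
    with refl , e′⊆e , c⊆c′ ← tail-determined (sym len) va f
       | _ , e⊆e′ , c′⊆c ← tail-determined len vb (λ w v r → g w v (trans r (cong (2 +_) len))) =
    cong₂ (λ c e → c ∷ e ∷ q) (⊆-antisym c⊆c′ c′⊆c) (⊆-antisym e⊆e′ e′⊆e)

  clean⇒tail-equal : ∀ i (H : PartiteGraph (3 + i)) (M : Model H) {A} →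
                     A ⊆ PartiteGraph.part H (2 + i) → CleanCondition (suc i) H A →
                     ∀ {x y} → x ∈ A → y ∈ A → tail (Model.node M x) ≡ tail (Model.node M y)
  clean⇒tail-equal 0 H M A⊆ _ {x} {y} x∈A y∈A =
    tail-equal₀ (node x) (node y) (∈part⁻ (A⊆ x∈A)) (∈part⁻ (A⊆ y∈A))
    where open Model M
  clean⇒tail-equal 1 H M A⊆ (_ , _ , same) {x} {y} x∈A y∈A =
    tail-equal₁ (node x) (node y) (∈part⁻ (A⊆ x∈A)) (∈part⁻ (A⊆ y∈A))
      (λ v → transport x∈A y∈A (vtx v) tt refl) (λ v → transport y∈A x∈A (vtx v) tt refl)
    where
    open Model M
    transport = Later.same⇒ H M A⊆ same (s≤s z≤n)
  clean⇒tail-equal (suc (suc i)) H M A⊆ (_ , same , _) {x} {y} x∈A y∈A =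
    tail-equal₂₊ (node x) (node y) (node-valid x) (node-valid y) (∈part⁻ (A⊆ x∈A)) (∈part⁻ (A⊆ y∈A))
      (transport x∈A y∈A) (transport y∈A x∈A)
    where
    open Model M
    transport = Later.same⇒ H M A⊆ same (s≤s (s≤s (s≤s (ℕ.n≤1+n _))))

  -- For `k = 3` the common neighbours in `V₀` are the two vertices of `c`. For `k ≥ 4` these are
  -- inherited from `e`, and only the strictness of `e ⊆ c` needs the clean condition.
  meet-chain : ∀ i (H : PartiteGraph (3 + i)) (M : Model H) {A} →
               A ⊆ PartiteGraph.part H (2 + i) → 2 ≤ ∣ A ∣ → CleanCondition (suc i) H A →
               ∀ {p} → length p ≡ i → (∀ {x} → x ∈ A → Model.node M x ≡ chn (head (Model.node M x)) p) →
               Chain (⋂[ A ] (head ∘ Model.node M) ∷ p)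
  meet-chain 0 H M {A} A⊆ 2≤A (_ , 2≤V) {[]} _ node≡ = c-intersection two ∷ [] , [-]
    where
    open Model M
    open Later H M
    open Fan A⊆ 2≤A node≡
    two : AtLeastTwo (_∈ c)
    two = Realise.twoVertices⁻ M {Below A 0} {_∈ c} proj₁
      (λ {v} b → ∈⋂⁺ A (λ x∈A → subst (_▷ vtx v) (node≡ x∈A) (proj₂ b x∈A)))
      (common⁻ A⊆ nonempty (s≤s z≤n) 2≤V)
  meet-chain (suc i) H M {A} A⊆ 2≤A cl {e ∷ q} len node≡ =
    c-intersection two ∷ proj₁ chain-p , e⊂c ∷ proj₂ chain-p
    where
    open Model M
    open Later H M
    open Fan A⊆ 2≤A node≡
    chain-p : Chain (e ∷ q)
    chain-p = chain-tail (chain (proj₂ nonempty))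

    e⊆c : e ⊆ c
    e⊆c v∈e = ∈⋂⁺ A (λ x∈A → proj₁ (Linkedˡ.head (proj₂ (chain x∈A))) v∈e)

    two : AtLeastTwo (_∈ c)
    two with u , v , ne , u∈ , v∈ ← twoVertices (Allˡ.head (proj₁ chain-p)) = u , v , ne , e⊆c u∈ , e⊆c v∈

    between : ∀ w → Below A (2 + i) w → ∃ λ f → w ≡ chn f q × e ⊆ f × f ⊆ c
    between w (rw , b) with ew , lw ← rank≡2+ rw with lq ← trans lw (sym (ℕ.suc-injective len)) =
      head w , trans ew (cong (chn _) (proj₁ (top (proj₂ nonempty)))) , proj₁ (proj₂ (top (proj₂ nonempty)))
      , (λ v∈f → ∈⋂⁺ A (λ x∈A → proj₂ (proj₂ (top x∈A)) v∈f))
      where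
      top : ∀ {x} → x ∈ A → tail w ≡ q × e ⊆ head w × head w ⊆ h x
      top {x} x∈A = ▷ᶜ-top lq (subst (chn (h x) (e ∷ q) ▷_) ew (subst (_▷ w) (node≡ x∈A) (b x∈A)))

    e⊂c : e ⊂ c
    -- Common neighbours in `V_{k-2}` are chains `chn f q` with `f` between `e` and `c`. Two
    -- distinct ones leave no room for `e ≡ c`.
    e⊂c = ⊆∧≢⇒⊂ e⊆c λ e≡c →
      let y , z , y≢z , by , bz = common⁻ A⊆ nonempty ℕ.≤-refl (clean⇒common₂₊ i H cl)
          f , ey , e⊆f , f⊆c = between (node y) by
          g , ez , e⊆g , g⊆c = between (node z) bz
          f≡e = ⊆-antisym (subst (f ⊆_) (sym e≡c) f⊆c) e⊆f
          g≡e = ⊆-antisym (subst (g ⊆_) (sym e≡c) g⊆c) e⊆g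
      in y≢z (node-injective (trans ey (trans (cong (λ b → chn b q) (trans f≡e (sym g≡e))) (sym ez))))

  laterStep : ∀ i (H : PartiteGraph (3 + i)) (M : Model H) → Step H M
  laterStep i H M = record
    { D∈V*        = λ { {p = c ∷ p} ch len → member ch (ℕ.suc-injective len) }
    ; D-cofinal   = cofinal′
    ; D-injective = λ { {p = _ ∷ _} {p′ = _ ∷ _} ch len ch′ len′ D⊆ →
        D-injectiveˢ ch (ℕ.suc-injective len) ch′ (ℕ.suc-injective len′) D⊆ }
    }
    where
    open PartiteGraph H
    open Model M
    open Later H M

    member : ∀ {d c p} → Chain (d ∷ c ∷ p) → length p ≡ i → V* H (D d (c ∷ p))
    member ch len = (A , A⊆part , 2≤∣∣⁺ twoA , 2≤∣∣⁺ two⋂ , D≡A∪⋂) , clean i H M ch len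
      where open Interval ch len

    cofinal′ : ∀ {X} → V* H X → ∃₂ λ o p → Chain (o ∷ p) × length p ≡ suc i × X ⊆ D o p
    cofinal′ ((A , A⊆ , 2≤A , _ , refl) , cl) with x , _ , _ , x∈A , _ ← 2≤∣∣⁻ 2≤A =
      d , c ∷ tail (node x) , proj₁ result , cong suc len , λ {_} → proj₂ result
      where
      cl′ : CleanCondition (suc i) H A
      cl′ = subst (CleanCondition (suc i) H) (⋂N∩part A⊆ (x , x∈A)) cl
      len : length (tail (node x)) ≡ i
      len = proj₂ (node-top (A⊆ x∈A))
      node≡ : ∀ {y} → y ∈ A → node y ≡ chn (head (node y)) (tail (node x))
      node≡ y∈A = trans (proj₁ (node-top (A⊆ y∈A))) (cong (chn _) (clean⇒tail-equal i H M A⊆ cl′ y∈A x∈A))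
      open Fan A⊆ 2≤A node≡
      result = cofinal (clean⇒common₁ i H cl′) (meet-chain i H M A⊆ 2≤A cl′ len node≡)

  step : ∀ i (H : PartiteGraph (2 + i)) (M : Model H) → Step H M
  step zero    H M = First.step H M
  step (suc i) H M = laterStep i H M

  -- The maximal elements of `V*`

  module _ {i} (H : PartiteGraph (2 + i)) (M : Model H) where
    open Model M
    open Step (step i H M)

    -- A larger element of `V*` would lie in another set of the form `D`. The resulting inclusion
    -- between two such sets makes them equal and squeezes out the extra vertex.
    D-maximal : ∀ {o p} → Chain (o ∷ p) → length p ≡ i → Maximal (V* H) (D o p)
    D-maximal {o} {p} ch len = D∈V* ch len , larger
      where
      larger : ¬ (∃[ Y ] V* H Y × D o p ⊂ Y)
      larger (Y , y , D⊆Y , v , v∈Y , v∉D) with o′ , p′ , ch′ , len′ , Y⊆ ← D-cofinal y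
        with refl , refl ← D-injective ch len ch′ len′ (λ v∈ → Y⊆ (D⊆Y v∈)) = v∉D (Y⊆ v∈Y)

    maximal⇒D : ∀ {X} → Maximal (V* H) X → ∃₂ λ o p → Chain (o ∷ p) × length p ≡ i × X ≡ D o p
    maximal⇒D {X} (x , largest) with o , p , ch , len , X⊆ ← D-cofinal x = o , p , ch , len ,
      decidable-stable (X ≟ˢ D o p) (λ X≢ → largest (D o p , D∈V* ch len , ⊆∧≢⇒⊂ X⊆ X≢))

  -- Labelling the graphs of the series

  module _ {i} (H : PartiteGraph (1 + i)) (Xs : List (Subset (PartiteGraph.order H))) where
    open PartiteGraph H
    open AddLevel H Xs using (Adj⁺; level⁺)

    -- Stated on the disjoint sum, so that old and new vertices are told apart by matching rather
    -- than by `splitAt`.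
    addLevel-model : (node⁺ : Vertex ⊎ Fin (length Xs) → Node) →
      (∀ u v → node⁺ u ≡ node⁺ v → u ≡ v) →
      (∀ u → Valid (node⁺ u)) →
      (∀ u → rank (node⁺ u) ≡ toℕ (level⁺ u)) →
      (∀ w → Valid w → rank w < 2 + i → ∃ λ u → node⁺ u ≡ w) →
      (∀ u v → toℕ (level⁺ v) < toℕ (level⁺ u) → Adj⁺ u v → node⁺ u ▷ node⁺ v) →
      (∀ u v → node⁺ u ▷ node⁺ v → Adj⁺ u v) →
      Model (addLevel H Xs)
    addLevel-model node⁺ inj valid rank≡ onto adj⇒ ⇒adj = record
      { node           = node⁺ ∘ splitAt order
      ; node-injective = λ {x} {y} e → trans (sym (Fin.join-splitAt order _ x))
          (trans (cong (Fin.join order _) (inj _ _ e)) (Fin.join-splitAt order _ y))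
      ; node-valid     = λ x → valid (splitAt order x)
      ; rank-node      = λ x → rank≡ (splitAt order x)
      ; vertexOf       = λ w v r → let u , e = onto w v r in
          Fin.join order _ u , trans (cong node⁺ (Fin.splitAt-join order _ u)) e
      ; adj⇒▷          = λ {x} {y} → adj⇒ (splitAt order x) (splitAt order y)
      ; ▷⇒adj          = λ {x} {y} → ⇒adj (splitAt order x) (splitAt order y)
      }

  B-model : Model (B G)
  B-model = addLevel-model (edgeless n) (maximalCliques G) [ vtx , clq ]′ inj valid rank≡ onto adj⇒ ⇒adj
    where
    open AddLevel (edgeless n) (maximalCliques G) using (Adj⁺; level⁺)
    node⁺ : Fin n ⊎ 𝒦 G → Node
    node⁺ = [ vtx , clq ]′
    inj : ∀ u v → node⁺ u ≡ node⁺ v → u ≡ v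
    inj (inj₁ _) (inj₁ _) refl = refl
    inj (inj₂ _) (inj₂ _) refl = refl
    valid : ∀ u → Valid (node⁺ u)
    valid (inj₁ _) = tt
    valid (inj₂ _) = tt
    rank≡ : ∀ u → rank (node⁺ u) ≡ toℕ (level⁺ u)
    rank≡ (inj₁ _) = refl
    rank≡ (inj₂ _) = refl
    onto : ∀ w → Valid w → rank w < 2 → ∃ λ u → node⁺ u ≡ w
    onto (vtx v)   _ _ = inj₁ v , refl
    onto (clq C)   _ _ = inj₂ C , refl
    onto (chn _ _) _ (s≤s (s≤s ()))
    adj⇒ : ∀ u v → toℕ (level⁺ v) < toℕ (level⁺ u) → Adj⁺ u v → node⁺ u ▷ node⁺ v
    adj⇒ (inj₂ _) (inj₁ _) _ r = r
    ⇒adj : ∀ u v → node⁺ u ▷ node⁺ v → Adj⁺ u v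
    ⇒adj (inj₂ _) (inj₁ _) r = r

  cleanFactor-model : ∀ {i} (H : PartiteGraph (2 + i)) → Model H → Model (cleanFactor H)
  cleanFactor-model {i} H M = addLevel-model H Xs node⁺ inj valid rank≡ onto adj⇒ ⇒adj
    where
    open PartiteGraph H
    open Model M
    Xs : List (Subset order)
    Xs = maximals (V*? H)
    open AddLevel H Xs using (Adj⁺; level⁺)

    code : ∀ j → ∃₂ λ o p → Chain (o ∷ p) × length p ≡ i × List.lookup Xs j ≡ D o p
    code j = maximal⇒D H M (lookup-maximals (V*? H) j)

    top : Fin (length Xs) → Subset n
    top j = proj₁ (code j)

    rest : Fin (length Xs) → List (Subset n)
    rest j = proj₁ (proj₂ (code j))

    code-chain : ∀ j → Chain (top j ∷ rest j)
    code-chain j = proj₁ (proj₂ (proj₂ (code j)))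

    code-length : ∀ j → length (rest j) ≡ i
    code-length j = proj₁ (proj₂ (proj₂ (proj₂ (code j))))

    code-D : ∀ j → List.lookup Xs j ≡ D (top j) (rest j)
    code-D j = proj₂ (proj₂ (proj₂ (proj₂ (code j))))

    node⁺ : Vertex ⊎ Fin (length Xs) → Node
    node⁺ = [ node , (λ j → chn (top j) (rest j)) ]′

    rank≡ : ∀ u → rank (node⁺ u) ≡ toℕ (level⁺ u)
    rank≡ (inj₁ x) = trans (rank-node x) (sym (Fin.toℕ-inject₁ (level x)))
    rank≡ (inj₂ j) = trans (cong (2 +_) (code-length j)) (sym (Fin.toℕ-fromℕ (2 + i)))

    old≢new : ∀ x j → node x ≢ node⁺ (inj₂ j)
    old≢new x j e = ℕ.<⇒≢ (Fin.toℕ<n (level x))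
      (trans (sym (rank-node x)) (trans (cong rank e) (trans (rank≡ (inj₂ j)) (Fin.toℕ-fromℕ (2 + i)))))

    inj : ∀ u v → node⁺ u ≡ node⁺ v → u ≡ v
    inj (inj₁ x) (inj₁ y) e = cong inj₁ (node-injective e)
    inj (inj₁ x) (inj₂ j) e = contradiction e (old≢new x j)
    inj (inj₂ i) (inj₁ y) e = contradiction (sym e) (old≢new y i)
    inj (inj₂ i) (inj₂ j) e = cong inj₂ (maximals-injective (V*? H) (trans (code-D i)
      (trans (cong₂ D (proj₁ (chn-injective e)) (proj₂ (chn-injective e))) (sym (code-D j)))))

    valid : ∀ u → Valid (node⁺ u)
    valid (inj₁ x) = node-valid x
    valid (inj₂ j) = code-chain j

    top-onto : ∀ w → Valid w → rank w ≡ 2 + i → ∃ λ u → node⁺ u ≡ w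
    top-onto (chn o p) v e =
      let len     = ℕ.suc-injective (ℕ.suc-injective e)
          j , ej  = maximals-complete (V*? H) (D-maximal H M v len)
          -- The label picked by `code` comes from an existence statement; that it is the given
          -- chain follows because both have the same `D`.
          eo , ep = Step.D-injective (step i H M) (code-chain j) (code-length j) v len
                      (λ x∈ → subst (_ ∈_) (trans (sym (code-D j)) ej) x∈)
      in inj₂ j , cong₂ chn eo ep

    onto : ∀ w → Valid w → rank w < 3 + i → ∃ λ u → node⁺ u ≡ w
    onto w v r = [ old , top-onto w v ]′ (ℕ.m≤n⇒m<n∨m≡n (ℕ.≤-pred r))
      where
      old : rank w < 2 + i → ∃ λ u → node⁺ u ≡ w
      old r = let x , e = vertexOf w v r in inj₁ x , e

    adj⇒ : ∀ u v → toℕ (level⁺ v) < toℕ (level⁺ u) → Adj⁺ u v → node⁺ u ▷ node⁺ v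
    adj⇒ (inj₁ x) (inj₁ y) l r = adj⇒▷ (subst₂ _<_ (Fin.toℕ-inject₁ _) (Fin.toℕ-inject₁ _) l) r
    adj⇒ (inj₁ x) (inj₂ j) l r = contradiction l (ℕ.<⇒≯ (subst₂ _<_
      (sym (Fin.toℕ-inject₁ _)) (sym (Fin.toℕ-fromℕ (2 + i))) (Fin.toℕ<n (level x))))
    adj⇒ (inj₂ j) (inj₁ y) l r = ∈D⁻ (subst (y ∈_) (code-D j) r)

    ⇒adj : ∀ u v → node⁺ u ▷ node⁺ v → Adj⁺ u v
    ⇒adj (inj₁ x) (inj₁ y) r = ▷⇒adj r
    ⇒adj (inj₁ x) (inj₂ j) r = contradiction (▷⇒rank< _ _ r) (ℕ.<⇒≯ (subst₂ _<_
      (sym (rank-node x)) (sym (trans (rank≡ (inj₂ j)) (Fin.toℕ-fromℕ (2 + i)))) (Fin.toℕ<n (level x))))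
    ⇒adj (inj₂ j) (inj₁ y) r = subst (y ∈_) (sym (code-D j)) (∈D⁺ r)
    ⇒adj (inj₂ j) (inj₂ j′) r = contradiction
      (trans (rank≡ (inj₂ j′)) (sym (rank≡ (inj₂ j)))) (ℕ.<⇒≢ (▷⇒rank< _ _ r))

  -- Labelling the stages, including the end of the series

  record StageModel {i} (s : Stage G (2 + i)) : Set where
    open Stage s
    field
      model       : Model partiteGraph
    open Model model public
    field
      node-vertex : ∀ v → node (vertex v) ≡ vtx v
      node-clique : ∀ C → node (clique C) ≡ clq C

  -- A missing graph of the series certifies that there is no chain naming a vertex of its last level.
  SeriesModel : ∀ i → Maybe (Stage G (2 + i)) → Set
  SeriesModel i nothing  = ∀ xs → Chain xs → length xs ≢ i
  SeriesModel i (just s) = StageModel s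

  nextStage-model : ∀ {i} (s : Stage G (2 + i)) → StageModel s → SeriesModel (suc i) (nextStage G s)
  nextStage-model {i} s M = if-elim (SeriesModel (suc i)) (null (maximals (V*? (Stage.partiteGraph s))))
    (λ eq → λ
      { (o ∷ p) ch len → null⇒¬lookup eq (maximals-complete (V*? (Stage.partiteGraph s))
          (D-maximal _ model ch (ℕ.suc-injective len)))
      })
    (λ _ → record
      { model       = cleanFactor-model (Stage.partiteGraph s) model
      ; node-vertex = λ v → trans (cong [ node , _ ]′ (Fin.splitAt-↑ˡ _ (Stage.vertex s v) _)) (node-vertex v)
      ; node-clique = λ C → trans (cong [ node , _ ]′ (Fin.splitAt-↑ˡ _ (Stage.clique s C) _)) (node-clique C)
      })
    where open StageModel M

  bind-model : ∀ {i} (s : Maybe (Stage G (2 + i))) → SeriesModel i s → SeriesModel (suc i) (s >>= nextStage G)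
  bind-model (just s) M    = nextStage-model s M
  -- A stopped series stays stopped: the tail of a longer chain would have the length already
  -- excluded.
  bind-model nothing  none = λ { (o ∷ p) ch len → none p (chain-tail ch) (ℕ.suc-injective len) }

  series-model : ∀ i → SeriesModel i (series G i)
  series-model zero = record
    { model       = B-model
    ; node-vertex = λ v → cong [ vtx , clq ]′ (Fin.splitAt-↑ˡ n v _)
    ; node-clique = λ C → cong [ vtx , clq ]′ (Fin.splitAt-↑ʳ n _ C)
    }
  series-model (suc i) = bind-model (series G i) (series-model i)

  -- Characterising sequences and the bijection

  lookup-reverseᵛ-zero : ∀ o p (e : length (o ∷ p) ≡ suc m) →
                         Vec.lookup (reverseᵛ (o ∷ p) e) zero ≡ bottom o p
  lookup-reverseᵛ-zero o []      refl = refl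
  lookup-reverseᵛ-zero o (c ∷ p) refl =
    trans (lookup-∷ʳ-inject₁ (reverseᵛ p refl ∷ʳ c) o zero) (lookup-reverseᵛ-zero c p refl)

  -- The part of a chain xs consisting of o = O_{l+2} and the sets below it sees the same vertices of
  -- level V_{l+2} as xs.
  record Cut (l : ℕ) (xs : List (Subset n)) (o : Subset n) : Set where
    field
      next    : Subset n
      rest    : List (Subset n)
      length≡ : length rest ≡ l
      isChain : Chain (o ∷ next ∷ rest)
      cut⁺    : ∀ {ys} → (o ∷ next ∷ rest) ▷ᶜ ys → xs ▷ᶜ ys
      cut⁻    : ∀ {b q} → length q ≡ l → xs ▷ᶜ (b ∷ q) → (o ∷ next ∷ rest) ▷ᶜ (b ∷ q)

  cut-∷ : ∀ {d c p} → Chain (d ∷ c ∷ p) →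
          (∀ j → Cut (toℕ j) (c ∷ p) (Vec.lookup (reverseᵛ (c ∷ p) refl) (suc j))) →
          ∀ j → Cut (toℕ j) (d ∷ c ∷ p) (Vec.lookup (reverseᵛ (d ∷ c ∷ p) refl) (suc j))
  cut-∷ {d} {c} {p} ch cuts j with view j
  -- The last index selects the largest set `d`, so nothing is cut off. At any smaller index `d` is
  -- dropped and the cut of the tail is reused.
  ... | ‵fromℕ = subst (Cut (toℕ (Fin.fromℕ (length p))) (d ∷ c ∷ p))
    (sym (lookup-∷ʳ-fromℕ (reverseᵛ (c ∷ p) refl) d)) (record
    { next    = c
    ; rest    = p
    ; length≡ = sym (Fin.toℕ-fromℕ (length p))
    ; isChain = ch
    ; cut⁺    = λ r → r
    ; cut⁻    = λ _ r → r
    })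
  ... | ‵inject₁ j′ = subst₂ (λ l → Cut l (d ∷ c ∷ p)) (sym (Fin.toℕ-inject₁ j′))
    (sym (lookup-∷ʳ-inject₁ (reverseᵛ (c ∷ p) refl) d (suc j′))) (record
    { next    = next
    ; rest    = rest
    ; length≡ = length≡
    ; isChain = isChain
    ; cut⁺    = λ r → there (cut⁺ r)
    ; cut⁻    = lower
    })
    where
    open Cut (cuts j′)
    lower : ∀ {b q} → length q ≡ toℕ j′ → (d ∷ c ∷ p) ▷ᶜ (b ∷ q) → _ ▷ᶜ (b ∷ q)
    lower l (here _ _) = contradiction (sym l) (ℕ.<⇒≢ (Fin.toℕ<n j′))
    lower l (there r)  = cut⁻ l r

  cut : ∀ xs → Chain xs → (e : length xs ≡ suc m) (j : Fin m) →
        Cut (toℕ j) xs (Vec.lookup (reverseᵛ xs e) (suc j))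
  cut (_ ∷ [])    _  refl ()
  cut (d ∷ c ∷ p) ch refl j = cut-∷ ch (cut (c ∷ p) (chain-tail ch) refl) j

  module Last {m} (s : Stage G (3 + m)) (M : StageModel s) where
    open Stage s
    open StageModel M

    vertex∈N₀⁻ : ∀ {x v} → 0 < rank (node x) → v ∈ N₀ x → node x ▷ vtx v
    vertex∈N₀⁻ {x} {v} r v∈ = subst (node x ▷_) (node-vertex v)
      (proj₁ (∈N[]⁻ r (∈⟦⟧⁻ (λ v → vertex v ∈? N[ 0 ] x) v∈)))

    vertex∈N₀⁺ : ∀ {x v} → node x ▷ vtx v → v ∈ N₀ x
    vertex∈N₀⁺ {x} {v} r = ∈⟦⟧⁺ (λ v → vertex v ∈? N[ 0 ] x)
      (∈N[]⁺ (subst (node x ▷_) (sym (node-vertex v)) r) (cong rank (node-vertex v)))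

    clique∈N₁⁻ : ∀ {x C} → 1 < rank (node x) → C ∈ N₁ x → node x ▷ clq C
    clique∈N₁⁻ {x} {C} r C∈ = subst (node x ▷_) (node-clique C)
      (proj₁ (∈N[]⁻ r (∈⟦⟧⁻ (λ C → clique C ∈? N[ 1 ] x) C∈)))

    clique∈N₁⁺ : ∀ {x C} → node x ▷ clq C → C ∈ N₁ x
    clique∈N₁⁺ {x} {C} r = ∈⟦⟧⁺ (λ C → clique C ∈? N[ 1 ] x)
      (∈N[]⁺ (subst (node x ▷_) (sym (node-clique C)) r) (cong rank (node-clique C)))

    module Sequence (x : Vertex) (top : toℕ (level x) ≡ 2 + m) where

      o : Subset n
      o = head (node x)

      p : List (Subset n)
      p = tail (node x)

      rank-x : rank (node x) ≡ 2 + m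
      rank-x = trans (rank-node x) top

      node≡ : node x ≡ chn o p
      node≡ = proj₁ (rank≡2+ {w = node x} rank-x)

      len : length (o ∷ p) ≡ suc m
      len = cong suc (proj₂ (rank≡2+ {w = node x} rank-x))

      isChain : Chain (o ∷ p)
      isChain = subst Valid node≡ (node-valid x)

      Os : Vec (Subset n) (suc m)
      Os = reverseᵛ (o ∷ p) len

      strictChain : StrictChain G (suc m)
      strictChain = Os
        , all-reverseᵛ⁺ (Allˡ.map IsIntersection⇒𝒪 (proj₁ isChain)) len
        , linked-reverseᵛ⁺ (proj₂ isChain) len

      Os₀ : Vec.lookup Os zero ≡ N₀ x
      Os₀ = trans (lookup-reverseᵛ-zero o p len) (⊆-antisym
        (λ {v} v∈ → vertex∈N₀⁺ (subst (_▷ vtx v) (sym node≡) v∈))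
        (λ {v} v∈ → subst (_▷ vtx v) node≡ (vertex∈N₀⁻ (subst (0 <_) (sym rank-x) (s≤s z≤n)) v∈)))

      -- The vertices of `V_{2+j}` below `x` end in sets contained in `oⱼ`, and one of them ends in
      -- `oⱼ` itself. Since `K G` reverses inclusions, that one attains the intersection.
      Osₛ : ∀ j → 𝒪′ G (Vec.lookup Os (suc j)) × K G (Vec.lookup Os (suc j)) ≡ ⋂[ N[ 2 + toℕ j ] x ] N₁
      Osₛ j = (_ , closed⇒≡⋂K (closed (Allˡ.head (proj₁ isChain′)))) , ⊆-antisym forth back
        where
        open Cut (cut (o ∷ p) isChain len j) renaming (isChain to isChain′)
        oⱼ : Subset n
        oⱼ = Vec.lookup Os (suc j)

        forth : K G oⱼ ⊆ ⋂[ N[ 2 + toℕ j ] x ] N₁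
        forth {C} C∈ = ∈⋂⁺ (N[ 2 + toℕ j ] x) λ {y} y∈ →
          let r , ry = ∈N[]⁻ (subst (2 + toℕ j <_) (sym rank-x) (s≤s (s≤s (Fin.toℕ<n j)))) y∈
              ey , ly = rank≡2+ ry
              r′ = cut⁻ ly (subst₂ _▷_ node≡ ey r)
              b⊆oⱼ = proj₂ (proj₂ (▷ᶜ-top (trans ly (sym length≡)) r′))
          in clique∈N₁⁺ (subst (_▷ clq C) (sym ey) (λ {_} v∈ → K⁻ C∈ (b⊆oⱼ v∈)))

        back : ⋂[ N[ 2 + toℕ j ] x ] N₁ ⊆ K G oⱼ
        back {C} C∈ with y , ey ← vertexOf (chn oⱼ rest) (chain-skip isChain′)
                           (s≤s (s≤s (subst (_< suc m) (sym length≡) (ℕ.m≤n⇒m≤1+n (Fin.toℕ<n j))))) =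
          K⁺ (subst (_▷ clq C) ey (clique∈N₁⁻ (subst (λ w → 1 < rank w) (sym ey) (s≤s (s≤s z≤n)))
            (∈⋂⁻ (N[ 2 + toℕ j ] x) C∈
              (∈N[]⁺ (subst₂ _▷_ (sym node≡) (sym ey) (cut⁺ (here next⊆ (λ v → v))))
                (trans (cong rank ey) (cong (2 +_) length≡))))))
          where
          next⊆ : next ⊆ oⱼ
          next⊆ = proj₁ (Linkedˡ.head (proj₂ isChain′))

      characterising : ∀ Os′ → IsCharacterising (just s) (x , top) Os′ ⇔ Os′ ≡ Os
      characterising Os′ = mk⇔ unique λ { refl → Os₀ , Osₛ }
        where
        unique : IsCharacterising (just s) (x , top) Os′ → Os′ ≡ Os
        unique (e₀ , eₛ) = lookup-injective λ
          { zero    → trans e₀ (sym Os₀)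
          ; (suc j) → K-injective (proj₁ (eₛ j)) (proj₁ (Osₛ j)) (trans (proj₂ (eₛ j)) (sym (proj₂ (Osₛ j))))
          }

    bijection : Σ[ S ∈ (LastLevel (just s) → StrictChain G (suc m)) ]
                (∀ x Os → IsCharacterising (just s) x Os ⇔ Os ≡ proj₁ (S x)) ×
                Bijective _≡_ (_≡_ on proj₁) S
    bijection = S , (λ (x , top) → Sequence.characterising x top) , inj , surj
      where
      S : LastLevel (just s) → StrictChain G (suc m)
      S (x , top) = Sequence.strictChain x top

      vertex-≡ : ∀ {x y} (top : toℕ (level x) ≡ 2 + m) (top′ : toℕ (level y) ≡ 2 + m) →
                 x ≡ y → (x , top) ≡ (y , top′)
      vertex-≡ top top′ refl = cong (_ ,_) (ℕ.≡-irrelevant top top′)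

      inj : Injective _≡_ (_≡_ on proj₁) S
      inj {x , top} {y , top′} e =
        let eo , ep = List.∷-injective (reverseᵛ-injective (X.o ∷ X.p) (Y.o ∷ Y.p) X.len Y.len e)
        in vertex-≡ top top′ (node-injective (trans X.node≡ (trans (cong₂ chn eo ep) (sym Y.node≡))))
        where
        module X = Sequence x top
        module Y = Sequence y top′

      surj : ∀ Os → ∃ λ x → ∀ {z} → z ≡ x → proj₁ (S z) ≡ proj₁ Os
      surj (Os , os , ls) with reverseᵛ-surjective Os (Allᵛ.map 𝒪⇒IsIntersection os) ls
      ... | o ∷ p , qs , ks , len , e
        with x , ex ← vertexOf (chn o p) (qs , ks) (s≤s (s≤s (ℕ.≤-reflexive len))) =
        (x , top) , λ { refl → trans (reverseᵛ-cong xs≡ (Sequence.len x top) len) e }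
        where
        top : toℕ (level x) ≡ 2 + m
        top = trans (sym (rank-node x)) (trans (cong rank ex) (cong suc len))
        xs≡ : head (node x) ∷ tail (node x) ≡ o ∷ p
        xs≡ = cong₂ _∷_ (cong head ex) (cong tail ex)

  -- Generalised over the value `s` of the series, so that it can be matched on. If it is `nothing`,
  -- both sides are empty: a strict chain would contradict the certificate `none`.
  series-bijection : ∀ m (s : Maybe (Stage G (3 + m))) → SeriesModel (suc m) s →
              Σ[ S ∈ (LastLevel s → StrictChain G (suc m)) ]
              (∀ x Os → IsCharacterising s x Os ⇔ Os ≡ proj₁ (S x)) ×
              Bijective _≡_ (_≡_ on proj₁) S
  series-bijection m (just s) M    = Last.bijection s M
  series-bijection m nothing  none = (λ ()) , (λ ()) , (λ { {()} }) ,
    λ (Os , os , ls) → let xs , qs , ks , len , _ = reverseᵛ-surjective Os (Allᵛ.map 𝒪⇒IsIntersection os) ls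
                       in contradiction len (none xs (qs , ks))

theorem1 : ∀ {n} (G : Graph n) (m : ℕ) →
    Σ[ S ∈ (V[2+ m ] G → StrictChain G (suc m)) ]
      (∀ x Os → HasSequence G m x Os ⇔ Os ≡ proj₁ (S x)) ×
      Bijective _≡_ (_≡_ on proj₁) S
theorem1 G m = series-bijection m (series G (suc m)) (series-model (suc m))
  where open Nodes G
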